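{- Let $n\ge1$ and let $s=(s_1,\ldots,s_n)$ be a weakly increasing sequence of positive integers with $s_{i+1}-s_i\in\{0,1\}$ for all $i\in[n-1]$. Let $K$ be a field and let $K[\mathbf{x}]=K[x_I : I\text{ is an } s\text{ -lecture hall multiset}]$. Then there exists a term order $\succ$ on $K[\mathbf{x}]$ such that the marked set of binomials $$G=\{\underline{x_Ix_J}-x_{I^- }x_{J^- } : I\text{ and }J\text{ are } s\text{ -lecture hall multisets such that the collection }\{I,J\}\text{ is not minimal}\}$$ is a reduced Gröbner basis for the toric ideal $\mathcal{I}_n^s$ with respect to $\succ$. The initial ideal of $\mathcal{I}_n^s$ with respect to $\succ$ is generated by the underlined terms $x_Ix_J$, all of which are square-free.
   Context: Write $[n]=\{1,\ldots,n\}$ and set $s_{n+1}:=s_n+1$. The $s$-lecture hall simplex is $P_n^s=\{\lambda\in\mathbb{R}^n : 0\le\frac{\lambda_1}{s_1}\le\frac{\lambda_2}{s_2}\le\cdots\le\frac{\lambda_n}{s_n}\le 1\}$. Let $\varphi:\mathbb{R}^n\to\mathbb{R}^n$ be the linear map sending $x$ to the vector with $i$-th coordinate $x_i-x_{i-1}$ (where $x_0:=0$), let $h:\mathbb{R}^n\to\mathbb{R}^{n+1}$, $h(x)=(x_1,\ldots,x_n,s_{n+1}-\sum_{i=1}^nx_i)$, and let $A_n^s:=(h\circ\varphi)(P_n^s)\subset\mathbb{R}^{n+1}$. All points of $A_n^s$ have nonnegative coordinates. An $s$-lecture hall multiset is a multiset $\{1^{z_1},2^{z_2},\ldots,(n+1)^{z_{n+1}}\}$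 on $[n+1]$ (with $i$ having multiplicity $z_i$) for some $z=(z_1,\ldots,z_{n+1})\in A_n^s\cap\mathbb{Z}^{n+1}$; $z$ is called its multiplicity vector. The toric ideal $\mathcal{I}_n^s\subset K[\mathbf{x}]$ of $A_n^s$ is the kernel of the $K$-algebra homomorphism $K[\mathbf{x}]\to K[t_1^{\pm1},\ldots,t_{n+2}^{\pm1}]$ sending $x_I\mapsto t_1^{z_1}\cdots t_{n+1}^{z_{n+1}}t_{n+2}$, where $z$ is the multiplicity vector of $I$. For $x,y\in\mathbb{Z}^{n+1}$, $x\succ_{\mathrm{lex}}y$ means that the leftmost nonzero entry of $x-y$ is positive; multisets are ordered by $\succ_{\mathrm{lex}}$ via their multiplicity vectors. Collections of multisets may have repeated members and are always indexed in weakly decreasing lexicographic order, $I_1\succeq_{\mathrm{lex}}I_2\succeq_{\mathrm{lex}}\cdots\succeq_{\mathrm{lex}}I_k$. For two collections $\mathcal{I}=\{I_1,\ldots,I_k\}$, $\mathcal{J}=\{J_1,\ldots,J_k\}$ so indexed, $\mathcal{I}\succ\mathcal{J}$ means $I_r\succ_{\mathrm{lex}}J_r$ for the smallest index $r$ with $I_r\neq J_r$. Let $\Sigma\mathcal{I}$ denote the multiset union of the members of $\mathcal{I}$ (multiplicity vectors are added). A collection $\mathcal{I}$ of $k$ $s$-lecture hall multisets is minimal if $\mathcal{I}'\succ\mathcal{I}$ for every collection $\mathcal{I}'\ne\mathcal{I}$ of $k$ $s$-lecture hall multisets with $\Sigma\mathcal{I}'=\Sigma\mathcal{I}$. For $s$-lecture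 hall multisets $I,J$, $\{I^-,J^-\}$ denotes the unique minimal collection of two $s$-lecture hall multisets with $\Sigma\{I^-,J^-\}=\Sigma\{I,J\}$. A term order on $K[\mathbf{x}]$ is a total order on the monomials that is compatible with multiplication and for which $1$ is the smallest monomial. For a marked set of binomials, being a Gröbner basis with respect to $\succ$ includes that the underlined term of each binomial is its initial term. A Gröbner basis is reduced if the initial terms of its elements form the unique minimal generating set of the initial ideal and no non-initial term of any element is divisible by the initial term of any element. -}

module Defs where

open import Algebra.Apartness.Bundles using (HeytingField)
open import Algebra.Bundles using (CommutativeMonoid)
import Algebra.Construct.Pointwise as Pointwise
open import Data.Bool.Base using (if_then_else_)
open import Data.Fin.Base using (Fin; fromℕ)
open import Data.Fin.Properties using (all?)
open import Data.Integer.Base as ℤ using (+_)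
import Data.Integer.Properties as ℤ
open import Data.List.Base as List using (List; []; _∷_; _++_; cartesianProductWith)
open import Data.List.Membership.Propositional.Properties using (∈-∃++)
import Data.List.Membership.DecPropositional as DecMembership
open import Data.List.Relation.Binary.Permutation.Propositional using (_↭_; ↭-refl; ↭-sym; ↭-trans; prep)
open import Data.List.Relation.Binary.Permutation.Propositional.Properties using (++-commutativeMonoid; ∈-resp-↭; drop-mid; shift; ¬x∷xs↭[])
open import Data.List.Relation.Unary.All using (All)
open import Data.List.Relation.Unary.Any using (Any; here)
open import Data.Nat.Base as ℕ using (ℕ; suc; NonZero)
import Data.Nat.Properties as ℕ
open import Data.Product.Base using (∃; ∃₂; _×_; _,_; uncurry)
open import Data.Rational.Base as ℚ using (ℚ; 0ℚ; 1ℚ; _/_)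
open import Data.Sum.Base using (_⊎_)
open import Data.Vec.Base as Vec using (Vec; []; _∷_; _∷ʳ_)
import Data.Vec.Properties as Vec
open import Data.Vec.Relation.Binary.Lex.Strict using (Lex-<)
open import Data.Vec.Relation.Unary.Linked using (Linked)
open import Function.Base using (_∘_)
open import Level using (Level; 0ℓ; _⊔_) renaming (suc to lsuc)
open import Relation.Binary.Core using (Rel)
open import Relation.Binary.Definitions using (Decidable; DecidableEquality)
open import Relation.Binary.Structures using (IsTotalOrder)
open import Relation.Binary.PropositionalEquality.Core using (_≡_; refl)
open import Relation.Nullary using (¬_; yes; no; does)
open import Relation.Nullary.Decidable using (map′)
open import Relation.Unary using (Pred; _∈_; _≐_)

-- Elements are unreduced formal sums of terms c·u; two of them are equal
-- when all their coefficients agree.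

module MonoidAlgebra
  {c ℓ₁ ℓ₂ a ℓ : Level} (K : HeytingField c ℓ₁ ℓ₂)
  (M : CommutativeMonoid a ℓ) (_≟_ : Decidable (CommutativeMonoid._≈_ M))
  where

  private
    module K = HeytingField K
    module M = CommutativeMonoid M

  infix  4 _≈_
  infixl 7 _*_
  infixl 6 _+_ _-_

  Element : Set (c ⊔ a)
  Element = List (K.Carrier × M.Carrier)

  coeff : Element → M.Carrier → K.Carrier
  coeff []            u = K.0#
  coeff ((k , v) ∷ p) u = if does (v ≟ u) then k K.+ coeff p u else coeff p u

  _≈_ : Rel Element (ℓ₁ ⊔ a)
  p ≈ q = ∀ u → coeff p u K.≈ coeff q u

  term : K.Carrier → M.Carrier → Element
  term k u = (k , u) ∷ []

  constant : K.Carrier → Element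
  constant k = term k M.ε

  monomial : M.Carrier → Element
  monomial = term K.1#

  0ᴬ 1ᴬ : Element
  0ᴬ = []
  1ᴬ = monomial M.ε

  _+_ _-_ _*_ : Element → Element → Element
  p + q = p ++ q
  p - q = p ++ List.map (λ (k , u) → K.- k , u) q
  p * q = cartesianProductWith (λ (k , u) (l , v) → k K.* l , u M.∙ v) p q

  sum product : List Element → Element
  sum     = List.foldr _+_ 0ᴬ
  product = List.foldr _*_ 1ᴬ

-- A monomial in the variables V is the list of its variables with
-- repetitions, up to permutation _↭_; the product is _++_ and 1 is [].

Monomial : Set → Set
Monomial V = List V

module _ {V : Set} (_≟_ : DecidableEquality V) where

  open DecMembership _≟_ using (_∈?_)

  ↭-dec : Decidable (_↭_ {A = V})
  ↭-dec []       []       = yes ↭-refl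
  ↭-dec []       (y ∷ ys) = no (¬x∷xs↭[] ∘ ↭-sym)
  ↭-dec (x ∷ xs) ys with x ∈? ys
  ... | no  x∉ys = no λ p → x∉ys (∈-resp-↭ p (here refl))
  ... | yes x∈ys with ∈-∃++ x∈ys
  ...   | as , bs , refl =
    map′ (λ p → ↭-trans (prep x p) (↭-sym (shift x as bs)))
         (drop-mid [] as)
         (↭-dec xs (as ++ bs))

_∣_ : {V : Set} → Rel (Monomial V) 0ℓ
u ∣ v = ∃ λ w → u ++ w ↭ v

record TermOrder (V : Set) : Set₁ where
  infix 4 _≼_ _≺_
  field
    _≼_          : Rel (Monomial V) 0ℓ
    isTotalOrder : IsTotalOrder _↭_ _≼_
    compatible   : ∀ {u v} w → u ≼ v → u ++ w ≼ v ++ w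
    1-smallest   : ∀ u → [] ≼ u

  _≺_ : Rel (Monomial V) 0ℓ
  u ≺ v = u ≼ v × ¬ (u ↭ v)

-- Inclusion of sets of monomials, up to equality _↭_ of monomials.

_⊑_ : {V : Set} {ℓ ℓ′ : Level} → Pred (Monomial V) ℓ → Pred (Monomial V) ℓ′ → Set (ℓ ⊔ ℓ′)
S ⊑ T = ∀ {u} → u ∈ S → ∃ λ v → v ∈ T × u ↭ v

module Polynomials
  {c ℓ₁ ℓ₂ : Level} (K : HeytingField c ℓ₁ ℓ₂)
  {V : Set} (_≟_ : DecidableEquality V)
  where

  private module K = HeytingField K

  open MonoidAlgebra K (++-commutativeMonoid {A = V}) (↭-dec _≟_) public
    renaming (Element to Polynomial)

  ⟨_⟩ : ∀ {ℓ} → Pred Polynomial ℓ → Pred Polynomial (c ⊔ ℓ₁ ⊔ ℓ)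
  ⟨ S ⟩ f = ∃ λ (qgs : List (Polynomial × Polynomial)) →
    All (λ (q , g) → g ∈ S) qgs × f ≈ sum (List.map (uncurry _*_) qgs)

  Monomials : ∀ {ℓ} → Pred (Monomial V) ℓ → Pred Polynomial (c ⊔ ℓ)
  Monomials S f = ∃ λ u → u ∈ S × f ≡ monomial u

  IsMinimalGeneratingSet : ∀ {ℓ ℓ′} → Pred (Monomial V) ℓ → Pred Polynomial ℓ′ →
                           Set (c ⊔ ℓ₁ ⊔ lsuc ℓ ⊔ ℓ′)
  IsMinimalGeneratingSet {ℓ} S I =
    ⟨ Monomials S ⟩ ≐ I ×
    (∀ (T : Pred (Monomial V) ℓ) → T ⊑ S → ⟨ Monomials T ⟩ ≐ I → S ⊑ T)

  -- A binomial g with underlined monomial u is represented by (u , g).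

  MarkedSet : (ℓ : Level) → Set (c ⊔ lsuc ℓ)
  MarkedSet ℓ = Pred (Monomial V × Polynomial) ℓ

  MarkedTerms : ∀ {ℓ} → MarkedSet ℓ → Pred (Monomial V) (c ⊔ ℓ)
  MarkedTerms G u = ∃ λ g → (u , g) ∈ G

  OccursIn : Monomial V → Polynomial → Set ℓ₂
  OccursIn u f = coeff f u K.# K.0#

  module _ (≻ : TermOrder V) where

    open TermOrder ≻

    IsInitial : Polynomial → Monomial V → Set (ℓ₁ ⊔ ℓ₂)
    IsInitial f u = OccursIn u f × (∀ {v} → u ≺ v → coeff f v K.≈ K.0#)

    InitialIdeal : ∀ {ℓ} → Pred Polynomial ℓ → Pred Polynomial (c ⊔ ℓ₁ ⊔ ℓ₂ ⊔ ℓ)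
    InitialIdeal I = ⟨ Monomials (λ u → ∃ λ f → f ∈ I × IsInitial f u) ⟩

    record IsGröbnerBasis {ℓ ℓ′} (G : MarkedSet ℓ) (I : Pred Polynomial ℓ′) :
                          Set (c ⊔ ℓ₁ ⊔ ℓ₂ ⊔ ℓ ⊔ ℓ′) where
      field
        finite    : ∃ λ (ugs : List (Monomial V × Polynomial)) → ∀ {u g} → (u , g) ∈ G →
                    Any (λ (u′ , g′) → u ↭ u′ × g ≈ g′) ugs
        inIdeal   : ∀ {u g} → (u , g) ∈ G → g ∈ I
        marked    : ∀ {u g} → (u , g) ∈ G → IsInitial g u
        generates : ⟨ Monomials (MarkedTerms G) ⟩ ≐ InitialIdeal I

    record IsReducedGröbnerBasis {ℓ ℓ′} (G : MarkedSet ℓ) (I : Pred Polynomial ℓ′) :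
                                 Set (lsuc c ⊔ ℓ₁ ⊔ ℓ₂ ⊔ lsuc ℓ ⊔ ℓ′) where
      field
        isGröbnerBasis : IsGröbnerBasis G I
        minimal        : IsMinimalGeneratingSet (MarkedTerms G) (InitialIdeal I)
        reduced        : ∀ {u g v h w} → (u , g) ∈ G → (v , h) ∈ G →
                         OccursIn w g → ¬ (w ↭ u) → ¬ (v ∣ w)

module LaurentPolynomials
  {c ℓ₁ ℓ₂ : Level} (K : HeytingField c ℓ₁ ℓ₂) (k : ℕ) where

  open MonoidAlgebra K
    (Pointwise.commutativeMonoid (Fin k) ℤ.+-0-commutativeMonoid)
    (λ x y → all? λ i → x i ℤ.≟ y i) public
    renaming (Element to LaurentPolynomial)

-- The number of terms of the sequence s is n = suc m.

module LectureHall {m : ℕ} (s : Fin (suc m) → ℕ) (s-positive : ∀ i → NonZero (s i)) where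

  private
    n = suc m

  fromℕℚ : ℕ → ℚ
  fromℕℚ k = + k / 1

  -- s_{n+1} := s_n + 1

  s⁺ : ℕ
  s⁺ = suc (s (fromℕ m))

  -- Only lattice points of the polytopes are used below. As h ∘ φ is injective
  -- with integral inverse on its image, these do not depend on whether the
  -- polytopes are taken over ℝ or ℚ.

  LectureHallSimplex : Pred (Vec ℚ n) 0ℓ
  LectureHallSimplex x = Linked ℚ._≤_ (0ℚ ∷ (ratios ∷ʳ 1ℚ))
    where
    ratios : Vec ℚ n
    ratios = Vec.tabulate λ i → Vec.lookup x i ℚ.* (+ 1 / s i) {{s-positive i}}

  φ : Vec ℚ n → Vec ℚ n
  φ x = Vec.zipWith ℚ._-_ x (0ℚ ∷ Vec.init x)

  h : Vec ℚ n → Vec ℚ (suc n)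
  h x = x ∷ʳ (fromℕℚ s⁺ ℚ.- Vec.foldr′ ℚ._+_ 0ℚ x)

  A : Pred (Vec ℚ (suc n)) 0ℓ
  A y = ∃ λ x → x ∈ LectureHallSimplex × h (φ x) ≡ y

  -- The membership proof is irrelevant, so that _≡_ is equality of multiplicity
  -- vectors. Multiplicities in ℕ are no restriction, as A is nonnegative.

  record LectureHallMultiset : Set where
    constructor mkMultiset
    field
      multiplicities : Vec ℕ (suc n)
      .inA           : Vec.map fromℕℚ multiplicities ∈ A

  open LectureHallMultiset public

  _≟_ : DecidableEquality LectureHallMultiset
  mkMultiset y _ ≟ mkMultiset z _ with Vec.≡-dec ℕ._≟_ y z
  ... | yes refl = yes refl
  ... | no  y≢z  = no λ { refl → y≢z refl }

  infix 4 _≻ˡᵉˣ_ _≽ˡᵉˣ_ _≻ᶜ_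

  _≻ˡᵉˣ_ _≽ˡᵉˣ_ : Rel LectureHallMultiset 0ℓ
  I ≻ˡᵉˣ J = Lex-< _≡_ ℕ._>_ (multiplicities I) (multiplicities J)
  I ≽ˡᵉˣ J = I ≻ˡᵉˣ J ⊎ I ≡ J

  record Collection (k : ℕ) : Set where
    constructor mkCollection
    field
      members : Vec LectureHallMultiset k
      sorted  : Linked _≽ˡᵉˣ_ members

  open Collection public

  _≻ᶜ_ : {k : ℕ} → Rel (Collection k) 0ℓ
  𝓘 ≻ᶜ 𝓙 = Lex-< _≡_ _≻ˡᵉˣ_ (members 𝓘) (members 𝓙)

  union : {k : ℕ} → Collection k → Vec ℕ (suc n)
  union 𝓘 = Vec.foldr′ (Vec.zipWith ℕ._+_) (Vec.replicate (suc n) 0)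
                       (Vec.map multiplicities (members 𝓘))

  Minimal : {k : ℕ} → Pred (Collection k) 0ℓ
  Minimal {k} 𝓘 = (𝓘′ : Collection k) → ¬ (members 𝓘′ ≡ members 𝓘) →
                  union 𝓘′ ≡ union 𝓘 → 𝓘′ ≻ᶜ 𝓘

  -- x_{I₁}⋯x_{Iₖ} for the collection {I₁,…,Iₖ}.

  collectionMonomial : {k : ℕ} → Collection k → Monomial LectureHallMultiset
  collectionMonomial 𝓘 = Vec.toList (members 𝓘)

  UnderlinedTerms : Pred (Monomial LectureHallMultiset) 0ℓ
  UnderlinedTerms u = ∃ λ (IJ : Collection 2) → ¬ Minimal IJ × u ≡ collectionMonomial IJ

  module _ {c ℓ₁ ℓ₂ : Level} (K : HeytingField c ℓ₁ ℓ₂) where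

    private
      module P = Polynomials K _≟_
      module L = LaurentPolynomials K (suc (suc n))

    image : LectureHallMultiset → L.LaurentPolynomial
    image I = L.monomial (Vec.lookup (Vec.map +_ (multiplicities I) ∷ʳ + 1))

    -- The K-algebra homomorphism extending x_I ↦ image I.

    toricMap : P.Polynomial → L.LaurentPolynomial
    toricMap f = L.sum (List.map (λ (k , u) → L.constant k L.* L.product (List.map image u)) f)

    ToricIdeal : Pred P.Polynomial ℓ₁
    ToricIdeal f = toricMap f L.≈ L.0ᴬ

    -- {I⁻,J⁻} is specified by its defining property, which at most one
    -- collection of two multisets has.

    G : P.MarkedSet c
    G (u , g) = ∃₂ λ (IJ IJ⁻ : Collection 2) →
      ¬ Minimal IJ × Minimal IJ⁻ × union IJ⁻ ≡ union IJ ×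
      u ≡ collectionMonomial IJ ×
      g ≡ P.monomial (collectionMonomial IJ) P.- P.monomial (collectionMonomial IJ⁻)

-- Put δ₁ := 0 and δⱼ₊₁ := sⱼ₊₁ − sⱼ for j ≤ n, so that δₙ₊₁ = 1.  The lattice points of A are the
-- z ∈ ℕⁿ⁺¹ with sum sₙ₊₁ such that δⱼ ≤ zⱼ whenever zᵢ > 0 for some i < j.
-- As term order take the lexicographic one in which lexicographically larger multisets are larger
-- variables; on collections of equal size it is the order ≻ of the paper, so the claim is that a collection
-- all of whose pairs are minimal is the least one with its union.
--
-- If I ≻ J is a minimal pair first differing at a ≤ p, one cannot move a copy of p from I to J in exchange
-- for some q > p.  Suppose two collections X, Y of the same size and union have only minimal pairs and
-- first differ in column p.  There are rows r and t, say r < t, with X_r(p) > Y_r(p) and X_t(p) < Y_t(p).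
-- As the exchange is impossible for (X_r, X_t), some d > p has X_t(d) < δ_d; for the last such d, the same
-- argument bounds column d of X by 1 above row t, and X vanishes there from row t on, whereas the rows of Y
-- up to t all contain d.  So the sums of column d differ, a contradiction.  Hence the least collection of a
-- fibre, whose pairs are minimal, is the only one with this property.

{-# OPTIONS --safe #-}
module Submission where

open import Defs
open import Algebra.Apartness.Bundles using (HeytingField)
open import Algebra.Bundles using (CommutativeMonoid)
import Algebra.Construct.Pointwise as Pointwise
import Algebra.Properties.CommutativeMonoid.Sum as CommutativeMonoidSum
open import Data.Bool.Base using (true; false; if_then_else_)
open import Data.Empty using (⊥)
open import Data.Fin.Base as Fin using (Fin; zero; suc; toℕ; fromℕ; inject₁)
import Data.Fin.Properties as Fin
open import Data.Fin.Relation.Unary.Top using (view; ‵fromℕ; ‵inject₁)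
open import Data.Integer.Base as ℤ using (ℤ) renaming (+_ to pos)
import Data.Integer.Properties as ℤ
open import Data.List.Base as List using (List; []; _∷_; _++_; cartesianProductWith; concatMap; length; upTo)
open import Data.List.Membership.Propositional using (find; lose) renaming (_∈_ to _∈ᴸ_)
open import Data.List.Membership.Propositional.Properties using (∈-cartesianProductWith⁺; ∈-concatMap⁺; ∈-filter⁺; ∈-filter⁻; ∈-lookup; ∈-upTo⁺; ∈-∃++)
import Data.List.Properties as List
open import Data.List.Relation.Binary.Lex.Strict as Lexᴸ using (Lex-≤; base; halt; this; next)
open import Data.List.Relation.Binary.Permutation.Propositional as ↭ using (_↭_; ↭-isEquivalence; ↭-refl; ↭-reflexive; ↭-sym; ↭-trans; prep)
import Data.List.Relation.Binary.Permutation.Propositional.Properties as ↭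
import Data.List.Relation.Binary.Pointwise as Pointwiseᴸ
open import Data.List.Relation.Unary.All as All using (All; []; _∷_)
import Data.List.Relation.Unary.All.Properties as All
open import Data.List.Relation.Unary.AllPairs using (AllPairs; []; _∷_)
open import Data.List.Relation.Unary.Any using (Any; here; there)
open import Data.List.Relation.Unary.Linked using ([]; [-]; _∷_)
open import Data.List.Relation.Unary.Linked.Properties using (Linked⇒AllPairs)
import Data.List.Relation.Unary.Sorted.TotalOrder as Sorted
open import Data.List.Relation.Unary.Unique.Propositional using (Unique)
import Data.List.Sort.InsertionSort.Base as InsertionSort
import Data.List.Sort.InsertionSort.Properties as InsertionSortProperties
open import Data.Nat.Base as ℕ using (ℕ; zero; suc; _≤_; _<_; _∸_; z≤n; s≤s; NonZero)
open import Data.Nat.ListAction using () renaming (sum to sumᴸ)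
open import Data.Nat.ListAction.Properties using (sum-↭; sum-++)
import Data.Nat.Properties as ℕ
open import Data.Product.Base using (∃; ∃₂; _×_; _,_; proj₁; proj₂; uncurry)
open import Data.Rational.Base as ℚ using (ℚ; 0ℚ; 1ℚ; _/_; toℚᵘ)
import Data.Rational.Properties as ℚ
open import Data.Rational.Solver using (module +-*-Solver)
open import Data.Rational.Unnormalised.Base as ℚᵘ using (mkℚᵘ)
import Data.Rational.Unnormalised.Properties as ℚᵘ
open import Data.Sum.Base as Sum using (_⊎_; inj₁; inj₂)
open import Data.Unit.Base using (tt)
open import Data.Vec.Base as Vec using (Vec; []; _∷_; _∷ʳ_)
import Data.Vec.Properties as Vec
open import Data.Vec.Relation.Binary.Lex.Strict as Lexⱽ using (Lex-<; base; this; next)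
import Data.Vec.Relation.Binary.Pointwise.Inductive as Pointwiseⱽ
open import Data.Vec.Relation.Unary.Linked using (Linked; []; [-]; _∷_)
open import Function.Base using (_∘_; flip)
open import Level using (Level; 0ℓ)
open import Relation.Binary.Bundles using (DecTotalOrder)
import Relation.Binary.Construct.Flip.EqAndOrd as Flip
import Relation.Binary.Construct.StrictToNonStrict as NonStrict
open import Relation.Binary.Core using (Rel)
open import Relation.Binary.Definitions using (Decidable; DecidableEquality; Tri; tri<; tri≈; tri>)
open import Relation.Binary.PropositionalEquality using (_≡_; _≢_; _≗_; refl; sym; trans; cong; cong₂; subst; subst₂; isEquivalence; resp₂; module ≡-Reasoning)
open import Relation.Binary.Structures using (IsStrictTotalOrder; IsTotalOrder)
open import Relation.Nullary using (¬_; Dec; yes; no; does; contradiction; decidable-stable; recompute)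
open import Relation.Nullary.Decidable using (_×-dec_; _→-dec_; ¬?; dec-true; dec-false; map′)
open import Relation.Unary using (Pred; _∈_; _≐_)

-- Monoid algebras and monomial ideals

module HeytingFieldProperties {c ℓ₁ ℓ₂ : Level} (K : HeytingField c ℓ₁ ℓ₂) where
  open HeytingField K renaming (refl to ≈-refl; sym to ≈-sym; trans to ≈-trans)

  -- In a Heyting field two elements with invertible difference are apart, and here the difference
  -- has inverse 1.
  1#0 : 1# # 0#
  1#0 = invertible⇒# (1# , ≈-trans (*-identityˡ _) 1-0≈1 , ≈-trans (*-identityʳ _) 1-0≈1)
    where
    1-0≈1 : 1# - 0# ≈ 1#
    1-0≈1 = ≈-trans (+-congˡ (≈-trans (≈-sym (+-identityʳ _)) (-‿inverseˡ 0#))) (+-identityʳ 1#)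

  #-respˡ-≈ : ∀ {x y z} → x ≈ y → x # z → y # z
  #-respˡ-≈ {x} {y} {z} x≈y x#z with #-cotrans x#z y
  ... | inj₁ x#y = contradiction x#y (#-irrefl x≈y)
  ... | inj₂ y#z = y#z

module MonoidAlgebraProperties
  {c ℓ₁ ℓ₂ a ℓ : Level} (K : HeytingField c ℓ₁ ℓ₂)
  (M : CommutativeMonoid a ℓ) (_≟_ : Decidable (CommutativeMonoid._≈_ M))
  where

  private
    module K = HeytingField K
    module M = CommutativeMonoid M
  open MonoidAlgebra K M _≟_
  open import Relation.Binary.Reasoning.Setoid K.setoid

  coeff-∷-≈ : ∀ {k v} p {u} → v M.≈ u → coeff ((k , v) ∷ p) u K.≈ k K.+ coeff p u
  coeff-∷-≈ {k} {v} p {u} v≈u rewrite dec-true (v ≟ u) v≈u = K.refl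

  coeff-∷-≉ : ∀ {k v} p {u} → ¬ v M.≈ u → coeff ((k , v) ∷ p) u K.≈ coeff p u
  coeff-∷-≉ {k} {v} p {u} v≉u rewrite dec-false (v ≟ u) v≉u = K.refl

  coeff-++ : ∀ p q u → coeff (p ++ q) u K.≈ coeff p u K.+ coeff q u
  coeff-++ []            q u = K.sym (K.+-identityˡ _)
  coeff-++ ((k , v) ∷ p) q u with does (v ≟ u)
  ... | true  = K.trans (K.+-congˡ (coeff-++ p q u)) (K.sym (K.+-assoc k _ _))
  ... | false = coeff-++ p q u

  ++-cong : ∀ {p p′ q q′} → p ≈ p′ → q ≈ q′ → (p ++ q) ≈ (p′ ++ q′)
  ++-cong {p} {p′} {q} {q′} p≈p′ q≈q′ u = begin
    coeff (p ++ q) u           ≈⟨ coeff-++ p q u ⟩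
    coeff p u K.+ coeff q u    ≈⟨ K.+-cong (p≈p′ u) (q≈q′ u) ⟩
    coeff p′ u K.+ coeff q′ u  ≈⟨ coeff-++ p′ q′ u ⟨
    coeff (p′ ++ q′) u         ∎

  ∷-cong : ∀ {k l v w p q} → k K.≈ l → v M.≈ w → p ≈ q → ((k , v) ∷ p) ≈ ((l , w) ∷ q)
  ∷-cong {k} {l} {v} {w} {p} {q} k≈l v≈w p≈q u with w ≟ u
  ... | yes w≈u = K.trans (coeff-∷-≈ p (M.trans v≈w w≈u)) (K.+-cong k≈l (p≈q u))
  ... | no  w≉u = K.trans (coeff-∷-≉ p (λ v≈u → w≉u (M.trans (M.sym v≈w) v≈u))) (p≈q u)

  opposite-terms : ∀ {k l v w} → k K.+ l K.≈ K.0# → v M.≈ w → ((k , v) ∷ (l , w) ∷ []) ≈ []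
  opposite-terms {k} {l} {v} {w} k+l≈0 v≈w u with v ≟ u
  ... | yes v≈u = K.trans (K.+-congˡ (K.trans (coeff-∷-≈ [] (M.trans (M.sym v≈w) v≈u)) (K.+-identityʳ l))) k+l≈0
  ... | no  v≉u = coeff-∷-≉ [] (λ w≈u → v≉u (M.trans v≈w w≈u))

  -- An unreduced sum may carry one monomial in several terms. Deleting them all at once lets a
  -- whole coefficient be split off.
  remove : M.Carrier → Element → Element
  remove v []            = []
  remove v ((k , w) ∷ p) = if does (w ≟ v) then remove v p else (k , w) ∷ remove v p

  remove-length : ∀ v p → length (remove v p) ≤ length p
  remove-length v [] = z≤n
  remove-length v ((k , w) ∷ p) with does (w ≟ v)
  ... | true  = ℕ.m≤n⇒m≤1+n (remove-length v p)
  ... | false = s≤s (remove-length v p)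

  coeff-remove-≈ : ∀ {v w} p → w M.≈ v → coeff (remove v p) w K.≈ K.0#
  coeff-remove-≈ [] w≈v = K.refl
  coeff-remove-≈ {v} {w} ((k , x) ∷ p) w≈v with x ≟ v
  ... | yes _  = coeff-remove-≈ p w≈v
  ... | no x≉v = K.trans (coeff-∷-≉ (remove v p) (λ x≈w → x≉v (M.trans x≈w w≈v))) (coeff-remove-≈ p w≈v)

  coeff-remove-≉ : ∀ {v w} p → ¬ w M.≈ v → coeff (remove v p) w K.≈ coeff p w
  coeff-remove-≉ [] w≉v = K.refl
  coeff-remove-≉ {v} {w} ((k , x) ∷ p) w≉v with x ≟ v
  ... | yes x≈v = K.trans (coeff-remove-≉ p w≉v) (K.sym (coeff-∷-≉ p (λ x≈w → w≉v (M.trans (M.sym x≈w) x≈v))))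
  ... | no  x≉v with does (x ≟ w)
  ...   | true  = K.+-congˡ (coeff-remove-≉ p w≉v)
  ...   | false = coeff-remove-≉ p w≉v

  module _ {ℓ′ : Level} {P : Pred M.Carrier ℓ′} (P? : ∀ u → Dec (P u))
           (P-resp : ∀ {u v} → u M.≈ v → P u → P v) where

    -- Taken over a fibre of the toric map, this is a coefficient of the image; see
    -- `coeff-toricMap`.
    sumOver : Element → K.Carrier
    sumOver []            = K.0#
    sumOver ((k , u) ∷ p) = if does (P? u) then k K.+ sumOver p else sumOver p

    sumOver-∷-∈ : ∀ {k u} p → P u → sumOver ((k , u) ∷ p) K.≈ k K.+ sumOver p
    sumOver-∷-∈ {k} {u} p Pu rewrite dec-true (P? u) Pu = K.refl

    sumOver-remove : ∀ {v} → P v → ∀ p → sumOver p K.≈ coeff p v K.+ sumOver (remove v p)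
    sumOver-remove Pv [] = K.sym (K.+-identityˡ _)
    sumOver-remove {v} Pv ((k , w) ∷ p) with w ≟ v
    ... | yes w≈v = begin
      sumOver ((k , w) ∷ p)                          ≈⟨ sumOver-∷-∈ p (P-resp (M.sym w≈v) Pv) ⟩
      k K.+ sumOver p                                ≈⟨ K.+-congˡ (sumOver-remove Pv p) ⟩
      k K.+ (coeff p v K.+ sumOver (remove v p))     ≈⟨ K.+-assoc k _ _ ⟨
      (k K.+ coeff p v) K.+ sumOver (remove v p)     ∎
    ... | no  w≉v with P? w
    ...   | yes Pw = begin
      k K.+ sumOver p                                ≈⟨ K.+-congˡ (sumOver-remove Pv p) ⟩
      k K.+ (coeff p v K.+ sumOver (remove v p))     ≈⟨ K.+-assoc k _ _ ⟨
      (k K.+ coeff p v) K.+ sumOver (remove v p)     ≈⟨ K.+-congʳ (K.+-comm k _) ⟩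
      (coeff p v K.+ k) K.+ sumOver (remove v p)     ≈⟨ K.+-assoc _ k _ ⟩
      coeff p v K.+ (k K.+ sumOver (remove v p))     ∎
    ...   | no ¬Pw = sumOver-remove Pv p

    -- If the leading monomial lies in `P`, its terms are gathered into its coefficient, which is
    -- zero, and the rest is treated likewise. As `remove` returns no structural subterm, the
    -- recursion runs on a bound for the length.
    sumOver-vanishes : ∀ p → (∀ u → P u → coeff p u K.≈ K.0#) → sumOver p K.≈ K.0#
    sumOver-vanishes p = go (length p) p ℕ.≤-refl
      where
      go : ∀ n p → length p ≤ n → (∀ u → P u → coeff p u K.≈ K.0#) → sumOver p K.≈ K.0#
      go n       []            _         _    = K.refl
      go (suc n) ((k , v) ∷ p) (s≤s p≤n) ≈0 with P? v
      ... | no ¬Pv = go n p p≤n λ u Pu → K.trans (K.sym (coeff-∷-≉ p (λ v≈u → ¬Pv (P-resp (M.sym v≈u) Pu)))) (≈0 u Pu)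
      ... | yes Pv = begin
        k K.+ sumOver p                              ≈⟨ K.+-congˡ (sumOver-remove Pv p) ⟩
        k K.+ (coeff p v K.+ sumOver (remove v p))   ≈⟨ K.+-assoc k _ _ ⟨
        (k K.+ coeff p v) K.+ sumOver (remove v p)   ≈⟨ K.+-congʳ (coeff-∷-≈ p M.refl) ⟨
        coeff ((k , v) ∷ p) v K.+ sumOver (remove v p) ≈⟨ K.+-cong (≈0 v Pv) (go n (remove v p) (ℕ.≤-trans (remove-length v p) p≤n) rest) ⟩
        K.0# K.+ K.0#                                ≈⟨ K.+-identityˡ _ ⟩
        K.0#                                         ∎
        where
        rest : ∀ u → P u → coeff (remove v p) u K.≈ K.0#
        rest u Pu with u ≟ v
        ... | yes u≈v = coeff-remove-≈ p u≈v
        ... | no  u≉v = K.trans (coeff-remove-≉ p u≉v) (K.trans (K.sym (coeff-∷-≉ p (λ v≈u → u≉v (M.sym v≈u)))) (≈0 u Pu))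

    -- Appending the term −(coeff p u)·u makes every coefficient over P vanish.
    sumOver-unique : ∀ p {u} → P u → (∀ v → P v → ¬ u M.≈ v → coeff p v K.≈ K.0#) → sumOver p K.≈ coeff p u
    sumOver-unique p {u} Pu ≈0 = begin
      sumOver p                                             ≈⟨ K.+-identityˡ _ ⟨
      K.0# K.+ sumOver p                                    ≈⟨ K.+-congʳ (K.-‿inverseʳ _) ⟨
      (coeff p u K.+ K.- coeff p u) K.+ sumOver p           ≈⟨ K.+-assoc _ _ _ ⟩
      coeff p u K.+ (K.- coeff p u K.+ sumOver p)           ≈⟨ K.+-congˡ (sumOver-∷-∈ p Pu) ⟨
      coeff p u K.+ sumOver ((K.- coeff p u , u) ∷ p)       ≈⟨ K.+-congˡ (sumOver-vanishes ((K.- coeff p u , u) ∷ p) ≈0′) ⟩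
      coeff p u K.+ K.0#                                    ≈⟨ K.+-identityʳ _ ⟩
      coeff p u                                             ∎
      where
      coeff-cong : ∀ p {u v} → u M.≈ v → coeff p u K.≈ coeff p v
      coeff-cong []            u≈v = K.refl
      coeff-cong ((k , w) ∷ p) {u} {v} u≈v with w ≟ u
      ... | yes w≈u = K.trans (K.+-congˡ (coeff-cong p u≈v)) (K.sym (coeff-∷-≈ p (M.trans w≈u u≈v)))
      ... | no  w≉u = K.trans (coeff-cong p u≈v) (K.sym (coeff-∷-≉ p (λ w≈v → w≉u (M.trans w≈v (M.sym u≈v)))))

      ≈0′ : ∀ v → P v → coeff ((K.- coeff p u , u) ∷ p) v K.≈ K.0#
      ≈0′ v Pv with u ≟ v
      ... | yes u≈v = K.trans (K.+-congˡ (coeff-cong p (M.sym u≈v))) (K.-‿inverseˡ _)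
      ... | no  u≉v = ≈0 v Pv u≉v

module MonomialIdeals
  {c ℓ₁ ℓ₂ : Level} (K : HeytingField c ℓ₁ ℓ₂) {V : Set} (_≟_ : DecidableEquality V)
  where

  private module K = HeytingField K
  open Polynomials K _≟_
  open MonoidAlgebraProperties K (↭.++-commutativeMonoid {A = V}) (↭-dec _≟_) public
  open HeytingFieldProperties K public

  coeff-monomial : ∀ u → coeff (monomial u) u K.≈ K.1#
  coeff-monomial u = K.trans (coeff-∷-≈ [] (↭-refl {x = u})) (K.+-identityʳ _)

  *-monomial-∣ : ∀ {v w u} → v ++ w ↭ u → ∀ q → (q * monomial u) ≈ ((q * monomial w) * monomial v)
  *-monomial-∣ vw↭u [] = λ _ → K.refl
  *-monomial-∣ {v} {w} {u} vw↭u ((k , a) ∷ q) = ∷-cong {p = q * monomial u} {(q * monomial w) * monomial v}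
    (K.sym (K.*-identityʳ _)) a·u↭a·w·v (*-monomial-∣ vw↭u q)
    where
    a·u↭a·w·v : a ++ u ↭ (a ++ w) ++ v
    a·u↭a·w·v = ↭-trans (↭.++⁺ˡ a (↭-trans (↭-sym vw↭u) (↭.++-comm v w))) (↭-reflexive (sym (List.++-assoc a w v)))

  -- The quotient of a generator by its divisor in `T` is absorbed into the cofactor.
  ⟨⟩-⊆ : ∀ {ℓ ℓ′} {S : Pred (Monomial V) ℓ} {T : Pred (Monomial V) ℓ′} →
         (∀ {u} → S u → ∃ λ v → T v × v ∣ u) → ∀ {f} → ⟨ Monomials S ⟩ f → ⟨ Monomials T ⟩ f
  ⟨⟩-⊆ {S = S} {T} divisor (qgs , qgs∈S , f≈) =
    let qgs′ , qgs′∈T , eq = go qgs qgs∈S in qgs′ , qgs′∈T , λ u → K.trans (f≈ u) (eq u)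
    where
    go : ∀ qgs → All (λ (q , g) → Monomials S g) qgs →
         ∃ λ qgs′ → All (λ (q , g) → Monomials T g) qgs′ ×
                    sum (List.map (uncurry _*_) qgs) ≈ sum (List.map (uncurry _*_) qgs′)
    go [] [] = [] , [] , λ _ → K.refl
    go ((q , _) ∷ qgs) ((u , Su , refl) ∷ qgs∈S) with divisor Su | go qgs qgs∈S
    ... | v , Tv , w , vw↭u | qgs′ , qgs′∈T , eq =
      (q * monomial w , monomial v) ∷ qgs′ , (v , Tv , refl) ∷ qgs′∈T ,
      ++-cong {q * monomial u} {(q * monomial w) * monomial v}
              {sum (List.map (uncurry _*_) qgs)} {sum (List.map (uncurry _*_) qgs′)}
        (*-monomial-∣ vw↭u q) eq

  -- If no generator in the sum divided `u`, every summand would have coefficient zero at `u`,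
  -- whereas the coefficient of `monomial u` there is 1.
  monomial∈⟨⟩⁻ : ∀ {ℓ} {T : Pred (Monomial V) ℓ} {u} → ⟨ Monomials T ⟩ (monomial u) → ∃ λ v → T v × v ∣ u
  monomial∈⟨⟩⁻ {T = T} {u} (qgs , qgs∈T , u≈) with go qgs qgs∈T
    where
    term-coeff : ∀ q t → (t ∣ u) ⊎ coeff (q * monomial t) u K.≈ K.0#
    term-coeff [] t = inj₂ K.refl
    term-coeff ((k , a) ∷ q) t with ↭-dec _≟_ (a ++ t) u
    ... | yes at↭u = inj₁ (a , ↭-trans (↭.++-comm t a) at↭u)
    ... | no  _    = term-coeff q t
    go : ∀ qgs → All (λ (q , g) → Monomials T g) qgs →
         (∃ λ v → T v × v ∣ u) ⊎ coeff (sum (List.map (uncurry _*_) qgs)) u K.≈ K.0#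
    go [] [] = inj₂ K.refl
    go ((q , _) ∷ qgs) ((t , Tt , refl) ∷ qgs∈T) with term-coeff q t | go qgs qgs∈T
    ... | inj₁ t∣u | _ = inj₁ (t , Tt , t∣u)
    ... | inj₂ _   | inj₁ found = inj₁ found
    ... | inj₂ ≈0  | inj₂ ≈0′ = inj₂ (K.trans (coeff-++ (q * monomial t) _ u) (K.trans (K.+-cong ≈0 ≈0′) (K.+-identityˡ _)))
  ... | inj₁ found = found
  ... | inj₂ ≈0 = contradiction 1#0 (K.#-irrefl (K.trans (K.sym (coeff-monomial u)) (K.trans (u≈ u) ≈0)))

  monomial∈⟨⟩⁺ : ∀ {ℓ} {S : Pred (Monomial V) ℓ} {u} → S u → ⟨ Monomials S ⟩ (monomial u)
  monomial∈⟨⟩⁺ {u = u} Su = (monomial [] , monomial u) ∷ [] , (u , Su , refl) ∷ [] ,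
    ∷-cong {p = []} {[]} (K.sym (K.*-identityˡ _)) (↭-refl {x = u}) (λ _ → K.refl)

-- Exchanges in collections

open import Data.Nat.Base using (_+_; _*_)
open CommutativeMonoidSum ℕ.+-0-commutativeMonoid using (sum; sum-cong-≗; ∑-distrib-+)

sum-mono-≤ : ∀ {n} {f g : Fin n → ℕ} → (∀ i → f i ≤ g i) → sum f ≤ sum g
sum-mono-≤ {zero}  f≤g = z≤n
sum-mono-≤ {suc n} f≤g = ℕ.+-mono-≤ (f≤g zero) (sum-mono-≤ (f≤g ∘ suc))

sum-mono-< : ∀ {n} {f g : Fin n → ℕ} → (∀ i → f i ≤ g i) → ∀ j → f j < g j → sum f < sum g
sum-mono-< f≤g zero    fj<gj = ℕ.+-mono-<-≤ fj<gj (sum-mono-≤ (f≤g ∘ suc))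
sum-mono-< f≤g (suc j) fj<gj = ℕ.+-mono-≤-< (f≤g zero) (sum-mono-< (f≤g ∘ suc) j fj<gj)

-- Otherwise `f ≤ g` everywhere and strictly at `r`, so that the sums would differ.
sum≡∧≢⇒∃> : ∀ {n} {f g : Fin n → ℕ} → sum f ≡ sum g → ∀ r → f r ≢ g r → ∃ λ i → g i < f i
sum≡∧≢⇒∃> {f = f} {g} Σf≡Σg r fr≢gr with Fin.any? (λ i → g i ℕ.<? f i)
... | yes ∃i = ∃i
... | no  ∄i = contradiction Σf≡Σg (ℕ.<⇒≢ (sum-mono-< f≤g r (ℕ.≤∧≢⇒< (f≤g r) fr≢gr)))
  where
  f≤g : ∀ i → f i ≤ g i
  f≤g i = ℕ.≮⇒≥ λ gi<fi → ∄i (i , gi<fi)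

last-failure : ∀ {n} {P : Fin n → Set} → (∀ i → Dec (P i)) → ∀ j → ¬ P j →
               ∃ λ d → j Fin.≤ d × ¬ P d × (∀ e → d Fin.< e → P e)
last-failure {suc n} P? j ¬Pj with Fin.any? (λ i → ¬? (P? (suc i)))
last-failure {suc n} P? zero    ¬Pj | no all = zero , z≤n , ¬Pj , λ { (suc e) _ → decidable-stable (P? _) λ ¬P → all (e , ¬P) }
last-failure {suc n} P? (suc j) ¬Pj | no all = contradiction (j , ¬Pj) all
last-failure {suc n} P? zero    ¬Pj | yes (i , ¬Pi) with last-failure (P? ∘ suc) i ¬Pi
... | d , i≤d , ¬Pd , after = suc d , z≤n , ¬Pd , λ { (suc e) (s≤s d<e) → after e d<e }
last-failure {suc n} P? (suc j) ¬Pj | yes (i , ¬Pi) with last-failure (P? ∘ suc) j ¬Pj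
... | d , j≤d , ¬Pd , after = suc d , s≤s j≤d , ¬Pd , λ { (suc e) (s≤s d<e) → after e d<e }

-- The standard basis vectors, by recursion so that their entries and sums follow by induction.
unit : ∀ {n} → Fin n → Fin n → ℕ
unit zero    zero    = 1
unit zero    (suc i) = 0
unit (suc p) zero    = 0
unit (suc p) (suc i) = unit p i

unit-≡ : ∀ {n} (p : Fin n) → unit p p ≡ 1
unit-≡ zero    = refl
unit-≡ (suc p) = unit-≡ p

unit-≢ : ∀ {n} {p i : Fin n} → i ≢ p → unit p i ≡ 0
unit-≢ {p = zero}  {zero}  i≢p = contradiction refl i≢p
unit-≢ {p = zero}  {suc i} i≢p = refl
unit-≢ {p = suc p} {zero}  i≢p = refl
unit-≢ {p = suc p} {suc i} i≢p = unit-≢ (i≢p ∘ cong suc)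

+unit-< : ∀ {n} {a p : Fin n} {y z} → a Fin.< p → y < z → y + unit p a < z
+unit-< {a = a} {p} {y} a<p y<z
  rewrite unit-≢ {p = p} {a} (λ { refl → ℕ.<-irrefl refl a<p }) | ℕ.+-identityʳ y = y<z

sum-0 : ∀ n → sum {n} (λ _ → 0) ≡ 0
sum-0 zero    = refl
sum-0 (suc n) = sum-0 n

sum-unit : ∀ {n} (p : Fin n) → sum (unit p) ≡ 1
sum-unit {suc n} zero = cong suc (sum-0 n)
sum-unit (suc p) = sum-unit p

infix 4 _⊐_ _⊒_

-- Lexicographic comparison with the first differing index as an explicit witness, which the
-- exchange arguments inspect.
_⊐_ _⊒_ : ∀ {n} → (Fin n → ℕ) → (Fin n → ℕ) → Set
x ⊐ y = ∃ λ a → (∀ i → i Fin.< a → x i ≡ y i) × y a < x a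
x ⊒ y = x ⊐ y ⊎ x ≗ y

⊒-split : ∀ {n} {x y : Fin n → ℕ} → x ⊒ y → ∀ p →
          (∃ λ a → a Fin.< p × (∀ i → i Fin.< a → x i ≡ y i) × y a < x a) ⊎
          (∀ i → i Fin.< p → x i ≡ y i) × y p ≤ x p
⊒-split (inj₂ x≗y) p = inj₂ ((λ i _ → x≗y i) , ℕ.≤-reflexive (sym (x≗y p)))
⊒-split (inj₁ (a , eq , ya<xa)) p with Fin.<-cmp a p
... | tri< a<p _ _ = inj₁ (a , a<p , eq , ya<xa)
... | tri≈ _ refl _ = inj₂ (eq , ℕ.<⇒≤ ya<xa)
... | tri> _ _ p<a = inj₂ ((λ i i<p → eq i (ℕ.<-trans i<p p<a)) , ℕ.≤-reflexive (sym (eq p p<a)))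

-- Valid vectors and families without possible exchanges

module Combinatorics {L : ℕ} (δ : Fin L → ℕ) (δ≤1 : ∀ i → δ i ≤ 1) (N : ℕ) (Σδ<N : sum δ < N) where

  open import Data.Nat.Properties hiding (_≟_)

  Valid : (Fin L → ℕ) → Set
  Valid z = sum z ≡ N × (∀ i j → i Fin.< j → 0 < z i → δ j ≤ z j)

  valid? : ∀ z → Dec (Valid z)
  valid? z = (sum z ℕ.≟ N) ×-dec
    Fin.all? λ i → Fin.all? λ j → (i Fin.<? j) →-dec ((0 <? z i) →-dec (δ j ≤? z j))

  -- A weak form of minimality of the pair: only competitors with both members below `I` are
  -- excluded. Such a pair is smaller in whichever order its members are sorted.
  Irreducible : (Fin L → ℕ) → (Fin L → ℕ) → Set
  Irreducible I J = ∀ I′ J′ → Valid I′ → Valid J′ → (∀ i → I′ i + J′ i ≡ I i + J i) →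
                    I ⊐ I′ → I ⊐ J′ → ⊥

  module Move (x : Fin L → ℕ) {p q : Fin L} (p≢q : p ≢ q) (0<xp : 0 < x p) where

    -- One copy of `p` is replaced by `q`. The truncation is harmless because `0 < x p`; `balance`
    -- restates the move without subtraction.
    x′ : Fin L → ℕ
    x′ i = (x i + unit q i) ∸ unit p i

    balance : ∀ i → x′ i + unit p i ≡ x i + unit q i
    balance i with i Fin.≟ p
    ... | yes refl rewrite unit-≡ i = m∸n+n≡m (≤-trans 0<xp (m≤m+n (x i) _))
    ... | no  i≢p  rewrite unit-≢ i≢p = +-identityʳ _

    x′≤x : ∀ {i} → i ≢ q → x′ i ≤ x i
    x′≤x {i} i≢q = begin
      x′ i            ≤⟨ m∸n≤m _ (unit p i) ⟩
      x i + unit q i  ≡⟨ cong (x i +_) (unit-≢ i≢q) ⟩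
      x i + 0         ≡⟨ +-identityʳ _ ⟩
      x i             ∎
      where open ≤-Reasoning

    x≤x′ : ∀ {i} → i ≢ p → x i ≤ x′ i
    x≤x′ {i} i≢p rewrite unit-≢ i≢p = m≤m+n _ _

    x′≡x : ∀ {i} → i ≢ p → i ≢ q → x′ i ≡ x i
    x′≡x i≢p i≢q = ≤-antisym (x′≤x i≢q) (x≤x′ i≢p)

    1+x′p≡xp : suc (x′ p) ≡ x p
    1+x′p≡xp = begin
      suc (x′ p)          ≡⟨ +-comm 1 _ ⟩
      x′ p + 1            ≡⟨ cong (x′ p +_) (unit-≡ p) ⟨
      x′ p + unit p p     ≡⟨ balance p ⟩
      x p + unit q p      ≡⟨ cong (x p +_) (unit-≢ p≢q) ⟩
      x p + 0             ≡⟨ +-identityʳ _ ⟩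
      x p                 ∎
      where open ≡-Reasoning

    sum-x′ : sum x′ ≡ sum x
    sum-x′ = +-cancelʳ-≡ 1 _ _ (begin
      sum x′ + 1                   ≡⟨ cong (sum x′ +_) (sum-unit p) ⟨
      sum x′ + sum (unit p)        ≡⟨ ∑-distrib-+ x′ (unit p) ⟨
      sum (λ i → x′ i + unit p i)  ≡⟨ sum-cong-≗ balance ⟩
      sum (λ i → x i + unit q i)   ≡⟨ ∑-distrib-+ x (unit q) ⟩
      sum x + sum (unit q)         ≡⟨ cong (sum x +_) (sum-unit q) ⟩
      sum x + 1                    ∎)
      where open ≡-Reasoning

  -- Moving one `p` from `I` to `J` and one `q` back keeps the union and makes both vectors smaller
  -- than `I`: the first at `p`, the second at `a`. The summand `unit p a` accounts for the copy
  -- that `J` gains when `a` is `p`. The strict inequalities with `δ` allow the removals, and the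
  -- bound after `p` allows `J` to gain `p`.
  exchange : ∀ {I J} → Valid I → Valid J → ∀ {a p q} → a Fin.≤ p → p Fin.< q →
             (∀ i → i Fin.< a → I i ≡ J i) → J a + unit p a < I a → δ p < I p →
             (∀ d → p Fin.< d → δ d ≤ J d) → δ q < J q → ¬ Irreducible I J
  exchange {I} {J} (ΣI , I-valid) (ΣJ , J-valid) {a} {p} {q} a≤p p<q I≡J Ja<Ia δp<Ip δ≤J δq<Jq irr =
    irr M.x′ M′.x′ (trans M.sum-x′ ΣI , I′-valid) (trans M′.sum-x′ ΣJ , J′-valid)
        union≡ (p , (λ i i<p → sym (M.x′≡x (<⇒≢ᶠ i<p) (<⇒≢ᶠ (<-trans i<p p<q)))) , ≤-reflexive M.1+x′p≡xp)
        (a , agree , J′a<Ia)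
    where
    <⇒≢ᶠ : ∀ {n} {i j : Fin n} → i Fin.< j → i ≢ j
    <⇒≢ᶠ i<j refl = <-irrefl refl i<j
    p≢q : p ≢ q
    p≢q = <⇒≢ᶠ p<q
    module M  = Move I p≢q (≤-<-trans z≤n δp<Ip)
    module M′ = Move J (p≢q ∘ sym) (≤-<-trans z≤n δq<Jq)

    union≡ : ∀ i → M.x′ i + M′.x′ i ≡ I i + J i
    union≡ i = +-cancelʳ-≡ (unit p i + unit q i) _ _ (begin
      M.x′ i + M′.x′ i + (unit p i + unit q i)    ≡⟨ +-interchange (M.x′ i) (M′.x′ i) _ _ ⟩
      (M.x′ i + unit p i) + (M′.x′ i + unit q i)  ≡⟨ cong₂ _+_ (M.balance i) (M′.balance i) ⟩
      (I i + unit q i) + (J i + unit p i)         ≡⟨ +-interchange (I i) _ _ _ ⟩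
      I i + J i + (unit q i + unit p i)           ≡⟨ cong (I i + J i +_) (+-comm (unit q i) _) ⟩
      I i + J i + (unit p i + unit q i)           ∎)
      where
      open ≡-Reasoning
      open import Algebra.Properties.CommutativeSemigroup +-commutativeSemigroup
        renaming (interchange to +-interchange)

    I′-valid : ∀ i j → i Fin.< j → 0 < M.x′ i → δ j ≤ M.x′ j
    I′-valid i j i<j 0<I′i with j Fin.≟ p
    ... | yes refl = ≤-pred (subst (δ j <_) (sym M.1+x′p≡xp) δp<Ip)
    ... | no  j≢p  = ≤-trans δj≤Ij (M.x≤x′ j≢p)
      where
      δj≤Ij : δ j ≤ I j
      δj≤Ij with i Fin.≟ q
      -- The entry `q` may be new, but `p` comes earlier and was present in `I`, so it already
      -- demands `δ j`.
      ... | yes refl = I-valid p j (<-trans p<q i<j) (≤-<-trans z≤n δp<Ip)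
      ... | no  i≢q  = I-valid i j i<j (≤-trans 0<I′i (M.x′≤x i≢q))

    J′-valid : ∀ i j → i Fin.< j → 0 < M′.x′ i → δ j ≤ M′.x′ j
    J′-valid i j i<j 0<J′i with j Fin.≟ q
    ... | yes refl = ≤-pred (subst (δ j <_) (sym M′.1+x′p≡xp) δq<Jq)
    ... | no  j≢q  = ≤-trans δj≤Jj (M′.x≤x′ j≢q)
      where
      δj≤Jj : δ j ≤ J j
      δj≤Jj with p Fin.<? j
      ... | yes p<j = δ≤J j p<j
      -- Here `i < j ≤ p`, so `i` is not the gained entry and was already present in `J`.
      ... | no  p≮j = J-valid i j i<j (≤-trans 0<J′i (M′.x′≤x (<⇒≢ᶠ (<-≤-trans i<j (≮⇒≥ p≮j)))))

    agree : ∀ i → i Fin.< a → I i ≡ M′.x′ i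
    agree i i<a = trans (I≡J i i<a) (sym (M′.x′≡x (<⇒≢ᶠ (<-trans i<p p<q)) (<⇒≢ᶠ i<p)))
      where
      i<p : i Fin.< p
      i<p = <-≤-trans i<a a≤p

    J′a<Ia : M′.x′ a < I a
    J′a<Ia = ≤-<-trans (m∸n≤m _ (unit q a)) Ja<Ia

  module _ {k : ℕ} where

    record IsReducedFamily (X : Fin k → Fin L → ℕ) : Set where
      field
        valid       : ∀ r → Valid (X r)
        sorted      : ∀ {r t} → r Fin.< t → X r ⊒ X t
        irreducible : ∀ {r t} → r Fin.< t → Irreducible (X r) (X t)

    module _ {X Y : Fin k → Fin L → ℕ} (X-red : IsReducedFamily X) (Y-red : IsReducedFamily Y)
             (columns : ∀ i → sum (λ r → X r i) ≡ sum (λ r → Y r i)) where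

      private
        module X = IsReducedFamily X-red
        module Y = IsReducedFamily Y-red

      no-crossing : ∀ p → (∀ i → i Fin.< p → ∀ r → X r i ≡ Y r i) →
                    ∀ {r t} → r Fin.< t → Y r p < X r p → X t p < Y t p → ⊥
      no-crossing p agree {r} {t} r<t Yrp<Xrp Xtp<Ytp with Fin.all? (λ d → (p Fin.<? d) →-dec (δ d ≤? X t d))
      -- When `X t` meets `δ` everywhere after `p`, it can receive `p`; a surplus entry `q` to give
      -- back remains to be found.
      ... | yes δ≤Xt = contradiction (X.irreducible r<t) not-irreducible
        where
        -- Without a surplus after `p`, `X t` would be at most `Y t`, which meets `δ` after `p`
        -- because it contains `p`. The inequality is strict at `p`, yet both vectors have sum `N`.
        slack : ∃ λ q → p Fin.< q × δ q < X t q
        slack with Fin.any? (λ q → (p Fin.<? q) ×-dec (δ q <? X t q))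
        ... | yes q = q
        ... | no ∄q = contradiction (trans (proj₁ (X.valid t)) (sym (proj₁ (Y.valid t))))
                                    (<⇒≢ (sum-mono-< Xt≤Yt p Xtp<Ytp))
          where
          Xt≤Yt : ∀ i → X t i ≤ Y t i
          Xt≤Yt i with Fin.<-cmp i p
          ... | tri< i<p _ _ = ≤-reflexive (agree i i<p t)
          ... | tri≈ _ refl _ = <⇒≤ Xtp<Ytp
          ... | tri> _ _ p<i = ≤-trans (≮⇒≥ λ δi<Xti → ∄q (i , p<i , δi<Xti))
                                       (proj₂ (Y.valid t) p i p<i (≤-<-trans z≤n Xtp<Ytp))

        -- If `a` is `p`, then `X r p` exceeds 1, which bounds `δ p`. If `a < p`, then `X r` and
        -- hence `Y r` contains `a`, so `δ p ≤ Y r p < X r p`.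
        δp<Xrp : ∀ {a} → a Fin.≤ p → X t a + unit p a < X r a → δ p < X r p
        δp<Xrp {a} a≤p Xta<Xra with a Fin.≟ p
        ... | yes refl = ≤-<-trans (δ≤1 a) (≤-<-trans (≤-trans (≤-reflexive (sym (unit-≡ a))) (m≤n+m _ _)) Xta<Xra)
        ... | no  a≢p  = ≤-<-trans (proj₂ (Y.valid r) a p a<p
                            (subst (0 <_) (agree a a<p r) (≤-<-trans z≤n Xta<Xra))) Yrp<Xrp
          where
          a<p : a Fin.< p
          a<p = Fin.≤∧≢⇒< a≤p a≢p

        not-irreducible : ¬ Irreducible (X r) (X t)
        not-irreducible with ⊒-split (X.sorted r<t) p
        ... | inj₁ (a , a<p , eq , Xta<Xra) =
          let q , p<q , δq<Xtq = slack
              Xta<Xra′ = +unit-< a<p Xta<Xra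
          in exchange (X.valid r) (X.valid t) (<⇒≤ a<p) p<q eq Xta<Xra′
               (δp<Xrp (<⇒≤ a<p) Xta<Xra′) δ≤Xt δq<Xtq
        -- Rows `r` and `t` agree before `p` in `X`, hence also in `Y`, so that `Y t p ≤ Y r p`. The
        -- chain `X t p < Y t p ≤ Y r p < X r p` gives the gap of two that an exchange with `a = p`
        -- requires.
        ... | inj₂ (eq , _) with ⊒-split (Y.sorted r<t) p
        ...   | inj₁ (a , a<p , _ , Yta<Yra) =
          contradiction (trans (sym (agree a a<p t)) (trans (sym (eq a a<p)) (agree a a<p r))) (<⇒≢ Yta<Yra)
        ...   | inj₂ (_ , Ytp≤Yrp) =
          let q , p<q , δq<Xtq = slack
              Xtp<Xrp = subst (λ z → X t p + z < X r p) (sym (unit-≡ p))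
                          (subst (_< X r p) (+-comm 1 _) (≤-<-trans (≤-trans Xtp<Ytp Ytp≤Yrp) Yrp<Xrp))
          in exchange (X.valid r) (X.valid t) ≤-refl p<q eq Xtp<Xrp (δp<Xrp ≤-refl Xtp<Xrp) δ≤Xt δq<Xtq
      ... | no ∃d with Fin.¬∀⟶∃¬ L _ (λ d → (p Fin.<? d) →-dec (δ d ≤? X t d)) ∃d
      ...   | d₀ , ¬d₀ with last-failure (λ d → δ d ≤? X t d) d₀ (λ δ≤X → ¬d₀ λ _ → δ≤X)
      ...     | d , d₀≤d , δd≰Xtd , δ≤Xt =
        -- With `d` the last column where `X t` falls short of `δ`, no row of `X` exceeds that of
        -- `Y` in column `d`, and row `t` is strictly smaller.
        contradiction (columns d) (<⇒≢ (sum-mono-< Xd≤Yd t (<-≤-trans Xtd<1 (1≤Yd t (inj₂ refl)))))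
        where
        p<d : p Fin.< d
        p<d with p Fin.<? d₀
        ... | yes p<d₀ = <-≤-trans p<d₀ d₀≤d
        ... | no  p≮d₀ = contradiction (λ p<d₀ → contradiction p<d₀ p≮d₀) ¬d₀

        Xtd<1 : X t d < 1
        Xtd<1 = <-≤-trans (≰⇒> δd≰Xtd) (δ≤1 d)

        -- A positive entry before `d` would demand `δ d` at `d`.
        Xt≡0 : ∀ i → i Fin.≤ d → X t i ≡ 0
        Xt≡0 i i≤d with i Fin.≟ d
        ... | yes refl = n<1⇒n≡0 Xtd<1
        ... | no  i≢d  = n≤0⇒n≡0 (≮⇒≥ λ 0<Xti → δd≰Xtd (proj₂ (X.valid t) i d (Fin.≤∧≢⇒< i≤d i≢d) 0<Xti))

        1≤δd : 1 ≤ δ d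
        1≤δd = ≤-<-trans z≤n (≰⇒> δd≰Xtd)

        0<Ytp : 0 < Y t p
        0<Ytp = ≤-<-trans z≤n Xtp<Ytp

        -- `Y t` contains `p`, and a row above it is lexicographically no smaller, so it contains
        -- some entry at or before `p`. That entry demands `δ d`, which is positive.
        1≤Yd : ∀ q → q Fin.< t ⊎ q ≡ t → 1 ≤ Y q d
        1≤Yd q (inj₂ refl) = ≤-trans 1≤δd (proj₂ (Y.valid q) p d p<d 0<Ytp)
        1≤Yd q (inj₁ q<t) with ⊒-split (Y.sorted q<t) p
        ... | inj₁ (a , a<p , _ , Yta<Yqa) =
          ≤-trans 1≤δd (proj₂ (Y.valid q) a d (<-trans a<p p<d) (≤-<-trans z≤n Yta<Yqa))
        ... | inj₂ (_ , Ytp≤Yqp) =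
          ≤-trans 1≤δd (proj₂ (Y.valid q) p d p<d (≤-trans 0<Ytp Ytp≤Yqp))

        -- `X t` vanishes up to `d`; were it at most `δ` beyond, its sum would not exceed the sum of
        -- `δ`, which is less than `N`.
        slack : ∃ λ e → d Fin.< e × δ e < X t e
        slack with Fin.any? (λ e → (d Fin.<? e) ×-dec (δ e <? X t e))
        ... | yes e = e
        ... | no ∄e = contradiction (proj₁ (X.valid t)) (<⇒≢ (≤-<-trans (sum-mono-≤ Xt≤δ) Σδ<N))
          where
          Xt≤δ : ∀ i → X t i ≤ δ i
          Xt≤δ i with d Fin.<? i
          ... | yes d<i = ≮⇒≥ λ δi<Xti → ∄e (i , d<i , δi<Xti)
          ... | no  d≮i = ≤-trans (≤-reflexive (Xt≡0 i (≮⇒≥ d≮i))) z≤n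

        -- With two copies of `d`, row `q` could spare one in exchange for the surplus `e` of row
        -- `t`.
        Xqd≤1 : ∀ q → q Fin.< t → X q d ≤ 1
        Xqd≤1 q q<t = ≮⇒≥ 1≮Xqd
          where
          1≮Xqd : ¬ 1 < X q d
          1≮Xqd 1<Xqd with slack | ⊒-split (X.sorted q<t) d
          ... | e , d<e , δe<Xte | inj₁ (a , a<d , eq , Xta<Xqa) =
            exchange (X.valid q) (X.valid t) (<⇒≤ a<d) d<e eq
              (+unit-< a<d Xta<Xqa)
              (≤-<-trans (δ≤1 d) 1<Xqd) δ≤Xt δe<Xte (X.irreducible q<t)
          ... | e , d<e , δe<Xte | inj₂ (eq , _) =
            exchange (X.valid q) (X.valid t) ≤-refl d<e eq
              (subst (_< X q d) (sym (cong₂ _+_ (Xt≡0 d ≤-refl) (unit-≡ d))) 1<Xqd)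
              (≤-<-trans (δ≤1 d) 1<Xqd) δ≤Xt δe<Xte (X.irreducible q<t)

        Xd≤Yd : ∀ q → X q d ≤ Y q d
        Xd≤Yd q with Fin.<-cmp q t
        ... | tri< q<t _ _ = ≤-trans (Xqd≤1 q q<t) (1≤Yd q (inj₁ q<t))
        ... | tri≈ _ refl _ = <⇒≤ (<-≤-trans Xtd<1 (1≤Yd q (inj₂ refl)))
        -- A row below `t` is lexicographically no larger than `X t`, so it vanishes up to `d` as
        -- well.
        ... | tri> _ _ t<q with ⊒-split (X.sorted t<q) d
        ...   | inj₁ (a , a<d , _ , Xqa<Xta) = contradiction (Xt≡0 a (<⇒≤ a<d)) (m<n⇒n≢0 Xqa<Xta)
        ...   | inj₂ (_ , Xqd≤Xtd) = ≤-trans (≤-trans Xqd≤Xtd (≤-reflexive (Xt≡0 d ≤-refl))) z≤n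

    -- By induction on the column. If column `p` differs, equality of its sums supplies a row where
    -- `X` is larger and one where `Y` is larger; `no-crossing` excludes either order of these rows,
    -- with `X` and `Y` interchanged in one case.
    reduced-unique : ∀ {X Y : Fin k → Fin L → ℕ} → IsReducedFamily X → IsReducedFamily Y →
                     (∀ i → sum (λ r → X r i) ≡ sum (λ r → Y r i)) → ∀ i r → X r i ≡ Y r i
    reduced-unique {X} {Y} X-red Y-red columns i = go (suc (toℕ i)) i ≤-refl
      where
      go : ∀ n i → toℕ i < n → ∀ r → X r i ≡ Y r i
      go (suc n) p p<1+n r = decidable-stable (X r p ℕ.≟ Y r p) λ Xrp≢Yrp →
        let agree : ∀ i → i Fin.< p → ∀ r → X r i ≡ Y r i
            agree = λ i i<p → go n i (<-≤-trans i<p (≤-pred p<1+n))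
            q , Yqp<Xqp = sum≡∧≢⇒∃> (columns p) r Xrp≢Yrp
            t , Xtp<Ytp = sum≡∧≢⇒∃> (sym (columns p)) r (Xrp≢Yrp ∘ sym)
        in case agree q Yqp<Xqp t Xtp<Ytp
        where
        case : (∀ i → i Fin.< p → ∀ r → X r i ≡ Y r i) → ∀ q → Y q p < X q p → ∀ t → X t p < Y t p → ⊥
        case agree q Yqp<Xqp t Xtp<Ytp with Fin.<-cmp q t
        ... | tri< q<t _ _ = no-crossing X-red Y-red columns p agree q<t Yqp<Xqp Xtp<Ytp
        ... | tri≈ _ refl _ = <-asym Yqp<Xqp Xtp<Ytp
        ... | tri> _ _ t<q = no-crossing Y-red X-red (sym ∘ columns) p (λ i i<p r → sym (agree i i<p r)) t<q Xtp<Ytp Yqp<Xqp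

-- Lattice points of A

ι : ℕ → ℚ
ι k = pos k / 1

toℚᵘ-/ : ∀ a d .{{_ : NonZero d}} → toℚᵘ (pos a / d) ℚᵘ.≃ pos a ℚᵘ./ d
toℚᵘ-/ a (suc d) = ℚ.toℚᵘ-fromℚᵘ (mkℚᵘ (pos a) d)

ι-+ : ∀ a b → ι (a + b) ≡ ι a ℚ.+ ι b
ι-+ a b = ℚ.toℚᵘ-injective (begin
  toℚᵘ (ι (a + b))  ≈⟨ toℚᵘ-/ (a + b) 1 ⟩
  pos (a + b) ℚᵘ./ 1
    ≈⟨ ℚᵘ.*≡* (cong (ℤ._* pos 1) (trans (ℤ.pos-+ a b)
                (sym (cong₂ ℤ._+_ (ℤ.*-identityʳ (pos a)) (ℤ.*-identityʳ (pos b)))))) ⟩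
  (pos a ℚᵘ./ 1) ℚᵘ.+ (pos b ℚᵘ./ 1) ≈⟨ ℚᵘ.+-cong (toℚᵘ-/ a 1) (toℚᵘ-/ b 1) ⟨
  toℚᵘ (ι a) ℚᵘ.+ toℚᵘ (ι b) ≈⟨ ℚ.toℚᵘ-homo-+ (ι a) (ι b) ⟨
  toℚᵘ (ι a ℚ.+ ι b)  ∎)
  where open ℚᵘ.≃-Reasoning

-- The unnormalised form exposes numerator and denominator, so that comparing ratios becomes cross
-- multiplication in ℕ.
ratioᵘ : ∀ a s .{{_ : NonZero s}} → toℚᵘ (ι a ℚ.* (pos 1 / s)) ℚᵘ.≃ pos a ℚᵘ./ s
ratioᵘ a s@(suc t) = begin
  toℚᵘ (ι a ℚ.* (pos 1 / s)) ≈⟨ ℚ.toℚᵘ-homo-* (ι a) (pos 1 / s) ⟩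
  toℚᵘ (ι a) ℚᵘ.* toℚᵘ (pos 1 / s) ≈⟨ ℚᵘ.*-cong (toℚᵘ-/ a 1) (toℚᵘ-/ 1 s) ⟩
  (pos a ℚᵘ./ 1) ℚᵘ.* (pos 1 ℚᵘ./ s)
    ≈⟨ ℚᵘ.*≡* (cong₂ ℤ._*_ (ℤ.*-identityʳ (pos a)) (cong pos (sym (ℕ.+-identityʳ s)))) ⟩
  pos a ℚᵘ./ s ∎
  where open ℚᵘ.≃-Reasoning

ratio-≤⁻ : ∀ a b s t .{{_ : NonZero s}} .{{_ : NonZero t}} →
  ι a ℚ.* (pos 1 / s) ℚ.≤ ι b ℚ.* (pos 1 / t) → a * t ≤ b * s
ratio-≤⁻ a b s@(suc _) t@(suc _) le with ℚᵘ.≤-respˡ-≃ (ratioᵘ a s) (ℚᵘ.≤-respʳ-≃ (ratioᵘ b t) (ℚ.toℚᵘ-mono-≤ le))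
... | ℚᵘ.*≤* p = ℤ.drop‿+≤+ (subst₂ ℤ._≤_ (sym (ℤ.pos-* a t)) (sym (ℤ.pos-* b s)) p)

ratio-≤⁺ : ∀ a b s t .{{_ : NonZero s}} .{{_ : NonZero t}} →
   a * t ≤ b * s → ι a ℚ.* (pos 1 / s) ℚ.≤ ι b ℚ.* (pos 1 / t)
ratio-≤⁺ a b s@(suc _) t@(suc _) le = ℚ.toℚᵘ-cancel-≤
  (ℚᵘ.≤-respˡ-≃ (ℚᵘ.≃-sym (ratioᵘ a s)) (ℚᵘ.≤-respʳ-≃ (ℚᵘ.≃-sym (ratioᵘ b t))
    (ℚᵘ.*≤* (subst₂ ℤ._≤_ (ℤ.pos-* a t) (ℤ.pos-* b s) (ℤ.+≤+ le)))))

ι-injective : ∀ {a b} → ι a ≡ ι b → a ≡ b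
ι-injective {a} {b} eq = ℕ.≤-antisym (f a b eq) (f b a (sym eq))
  where
  f : ∀ a b → ι a ≡ ι b → a ≤ b
  f a b eq = subst₂ _≤_ (ℕ.*-identityʳ a) (ℕ.*-identityʳ b) (ratio-≤⁻ a b 1 1 (ℚ.≤-reflexive (cong (ℚ._* 1ℚ) eq)))

-- `φ` with `b` in place of the initial value 0, so that an induction can drop the first coordinate.
diffs : ∀ {m} → ℚ → Vec ℚ (suc m) → Vec ℚ (suc m)
diffs b x = Vec.zipWith ℚ._-_ x (b ∷ Vec.init x)

ratios : ∀ {m} (s : Fin m → ℕ) → (∀ i → NonZero (s i)) → Vec ℚ m → Vec ℚ m
ratios s s-positive x = Vec.tabulate λ i → Vec.lookup x i ℚ.* (pos 1 / s i) {{s-positive i}}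

sumℚ : ∀ {m} → Vec ℚ m → ℚ
sumℚ = Vec.foldr′ ℚ._+_ 0ℚ

-- The conditions of the simplex with denominators cleared; c is the sum of the
-- multiplicities preceding the given ones, and s starts at the index of the
-- last of these.
LectureHallPoint : ∀ m → (Fin (suc m) → ℕ) → ℕ → Vec ℕ (suc m) → Set
LectureHallPoint zero    s c (w ∷ [])  = c ≤ s zero × c + w ≡ suc (s zero)
LectureHallPoint (suc m) s c (w ∷ ws) =
  c * s (suc zero) ≤ (c + w) * s zero × LectureHallPoint m (s ∘ suc) (c + w) ws

module _ where
  open +-*-Solver

  x≡b+[x-b] : ∀ x b → x ≡ b ℚ.+ (x ℚ.- b)
  x≡b+[x-b] = solve 2 (λ x b → x := b :+ (x :- b)) refl

  [b+w]-b≡w : ∀ b w → (b ℚ.+ w) ℚ.- b ≡ w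
  [b+w]-b≡w = solve 2 (λ b w → (b :+ w) :- b := w) refl

  telescope : ∀ e S y b → (e ℚ.+ S) ℚ.+ y ≡ (e ℚ.+ ((y ℚ.- b) ℚ.+ S)) ℚ.+ b
  telescope = solve 4 (λ e S y b → (e :+ S) :+ y := (e :+ ((y :- b) :+ S)) :+ b) refl

  telescope′ : ∀ t b y S → t ℚ.- b ℚ.- ((y ℚ.- b) ℚ.+ S) ≡ t ℚ.- y ℚ.- S
  telescope′ = solve 4 (λ t b y S → t :- b :- ((y :- b) :+ S) := t :- y :- S) refl

  [t-S]+S≡t : ∀ t S → (t ℚ.- S) ℚ.+ S ≡ t
  [t-S]+S≡t = solve 2 (λ t S → (t :- S) :+ S := t) refl

x-b≡w⇒x≡b+w : ∀ x b w → x ℚ.- ι b ≡ ι w → x ≡ ι (b + w)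
x-b≡w⇒x≡b+w x b w eq = begin
  x                    ≡⟨ x≡b+[x-b] x (ι b) ⟩
  ι b ℚ.+ (x ℚ.- ι b)  ≡⟨ cong (ι b ℚ.+_) eq ⟩
  ι b ℚ.+ ι w          ≡⟨ ι-+ b w ⟨
  ι (b + w)            ∎
  where open ≡-Reasoning

b+w-b≡w : ∀ b w → ι (b + w) ℚ.- ι b ≡ ι w
b+w-b≡w b w = trans (cong (ℚ._- ι b) (ι-+ b w)) ([b+w]-b≡w (ι b) (ι w))

-- The coordinates of `x` are recovered as partial sums of the multiplicities, starting from `b`.
-- The last coordinate `e` stays abstract: only its complement to the total is recorded, and
-- `telescope` passes this on to the tail.
fromSimplex : ∀ m s s-positive b (x : Vec ℚ (suc m)) e w ws →
  diffs (ι b) x ∷ʳ e ≡ Vec.map ι (w ∷ ws) →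
  (e ℚ.+ sumℚ (diffs (ι b) x)) ℚ.+ ι b ≡ ι (suc (s (fromℕ m))) →
  Linked ℚ._≤_ (ratios s s-positive x ∷ʳ 1ℚ) →
  LectureHallPoint m s (b + w) ws
fromSimplex zero s s-positive b (x ∷ []) e w (w′ ∷ []) eq total (x/s≤1 ∷ [-]) =
  subst₂ _≤_ (ℕ.*-identityʳ _) (ℕ.*-identityˡ _)
    (ratio-≤⁻ (b + w) 1 (s zero) 1 {{s-positive zero}}
      (subst (λ z → z ℚ.* 1/s ℚ.≤ 1ℚ) x≡b+w x/s≤1)) ,
  ι-injective (begin
    ι (b + w + w′)                           ≡⟨ cong ι (ℕ.+-comm (b + w) w′) ⟩
    ι (w′ + (b + w))                         ≡⟨ ι-+ w′ (b + w) ⟩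
    ι w′ ℚ.+ ι (b + w)                       ≡⟨ cong₂ ℚ._+_ (Vec.∷-injectiveˡ (Vec.∷-injectiveʳ eq)) x≡b+w ⟨
    e ℚ.+ x                                  ≡⟨ cong (ℚ._+ x) (ℚ.+-identityʳ e) ⟨
    (e ℚ.+ 0ℚ) ℚ.+ x                         ≡⟨ telescope e 0ℚ x (ι b) ⟩
    (e ℚ.+ ((x ℚ.- ι b) ℚ.+ 0ℚ)) ℚ.+ ι b     ≡⟨ total ⟩
    ι (suc (s zero))                         ∎)
  where
  open ≡-Reasoning
  1/s : ℚ
  1/s = (pos 1 / s zero) {{s-positive zero}}
  x≡b+w : x ≡ ι (b + w)
  x≡b+w = x-b≡w⇒x≡b+w x b w (Vec.∷-injectiveˡ eq)
fromSimplex (suc m) s s-positive b (x ∷ xs@(x₁ ∷ _)) e w (w₁ ∷ ws) eq total (x/s≤ ∷ linked) =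
  ratio-≤⁻ (b + w) (b + w + w₁) (s zero) (s (suc zero)) {{s-positive zero}} {{s-positive (suc zero)}}
    (subst₂ (λ y z → y ℚ.* 1/s₀ ℚ.≤ z ℚ.* 1/s₁) x≡b+w
      (x-b≡w⇒x≡b+w x₁ (b + w) w₁ (Vec.∷-injectiveˡ eq′)) x/s≤) ,
  fromSimplex m (s ∘ suc) (s-positive ∘ suc) (b + w) xs e w₁ ws eq′
    (subst (λ y → (e ℚ.+ sumℚ (diffs y xs)) ℚ.+ y ≡ ι (suc (s (suc (fromℕ m))))) x≡b+w
      (trans (telescope e (sumℚ (diffs x xs)) x (ι b)) total))
    linked
  where
  1/s₀ 1/s₁ : ℚ
  1/s₀ = (pos 1 / s zero) {{s-positive zero}}
  1/s₁ = (pos 1 / s (suc zero)) {{s-positive (suc zero)}}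
  x≡b+w : x ≡ ι (b + w)
  x≡b+w = x-b≡w⇒x≡b+w x b w (Vec.∷-injectiveˡ eq)
  eq′ : diffs (ι (b + w)) xs ∷ʳ e ≡ Vec.map ι (w₁ ∷ ws)
  eq′ = subst (λ y → diffs y xs ∷ʳ e ≡ Vec.map ι (w₁ ∷ ws)) x≡b+w (Vec.∷-injectiveʳ eq)

-- The inverse of `h ∘ φ` on its image, for `c = 0`. The last multiplicity only completes the total
-- and gives no coordinate.
partialSums : ∀ {m} → ℕ → Vec ℕ (suc m) → Vec ℚ m
partialSums c (w ∷ [])         = []
partialSums c (w ∷ ws@(_ ∷ _)) = ι (c + w) ∷ partialSums (c + w) ws

toSimplex-diffs : ∀ m s b w ws → LectureHallPoint m s (b + w) ws →
  let x = partialSums b (w ∷ ws) in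
  diffs (ι b) x ∷ʳ (ι (suc (s (fromℕ m))) ℚ.- ι b ℚ.- sumℚ (diffs (ι b) x)) ≡ Vec.map ι (w ∷ ws)
toSimplex-diffs zero s b w (w′ ∷ []) (b+w≤s , total) =
  cong₂ (λ x y → x ∷ y ∷ []) (b+w-b≡w b w) (begin
    ι (suc (s zero)) ℚ.- ι b ℚ.- ((ι (b + w) ℚ.- ι b) ℚ.+ 0ℚ)
      ≡⟨ telescope′ (ι (suc (s zero))) (ι b) (ι (b + w)) 0ℚ ⟩
    ι (suc (s zero)) ℚ.- ι (b + w) ℚ.+ 0ℚ
      ≡⟨ ℚ.+-identityʳ (ι (suc (s zero)) ℚ.- ι (b + w)) ⟩
    ι (suc (s zero)) ℚ.- ι (b + w)
      ≡⟨ cong (λ z → ι z ℚ.- ι (b + w)) total ⟨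
    ι (b + w + w′) ℚ.- ι (b + w)
      ≡⟨ b+w-b≡w (b + w) w′ ⟩
    ι w′ ∎)
  where open ≡-Reasoning
toSimplex-diffs (suc m) s b w (w₁ ∷ ws@(_ ∷ _)) (le , point) =
  cong₂ _∷_ (b+w-b≡w b w)
    (trans (cong (diffs (ι (b + w)) x ∷ʳ_)
             (telescope′ (ι (suc (s (suc (fromℕ m))))) (ι b) (ι (b + w)) (sumℚ (diffs (ι (b + w)) x))))
           (toSimplex-diffs m (s ∘ suc) (b + w) w₁ ws point))
  where
  x : Vec ℚ (suc m)
  x = partialSums (b + w) (w₁ ∷ ws)

toSimplex-linked : ∀ m s s-positive b w ws → LectureHallPoint m s (b + w) ws →
  Linked ℚ._≤_ (ratios s s-positive (partialSums b (w ∷ ws)) ∷ʳ 1ℚ)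
toSimplex-linked zero s s-positive b w (w′ ∷ []) (b+w≤s , total) =
  ratio-≤⁺ (b + w) 1 (s zero) 1 {{s-positive zero}}
    (subst₂ _≤_ (sym (ℕ.*-identityʳ _)) (sym (ℕ.*-identityˡ _)) b+w≤s) ∷ [-]
toSimplex-linked (suc m) s s-positive b w (w₁ ∷ ws@(_ ∷ _)) (le , point) =
  ratio-≤⁺ (b + w) (b + w + w₁) (s zero) (s (suc zero)) {{s-positive zero}} {{s-positive (suc zero)}} le ∷
  toSimplex-linked m (s ∘ suc) (s-positive ∘ suc) (b + w) w₁ ws point

module _ {m : ℕ} (s : Fin (suc m) → ℕ) (s-positive : ∀ i → NonZero (s i)) where
  open LectureHall s s-positive

  A⇒point : ∀ {w ws} → A (Vec.map fromℕℚ (w ∷ ws)) → LectureHallPoint m s w ws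
  A⇒point {w} {ws} (x@(_ ∷ _) , 0≤ ∷ linked , eq) =
    fromSimplex m s s-positive 0 x (ι s⁺ ℚ.- sumℚ (φ x)) w ws eq
      (trans (ℚ.+-identityʳ _) ([t-S]+S≡t (ι s⁺) (sumℚ (φ x)))) linked

  point⇒A : ∀ {w ws} → LectureHallPoint m s w ws → A (Vec.map fromℕℚ (w ∷ ws))
  point⇒A {w} {ws@(_ ∷ _)} point =
    x , ratio-≤⁺ 0 w 1 (s zero) {{_}} {{s-positive zero}} z≤n ∷ toSimplex-linked m s s-positive 0 w ws point ,
    trans (cong (λ z → φ x ∷ʳ (z ℚ.- sumℚ (φ x))) (sym (ℚ.+-identityʳ (ι s⁺))))
          (toSimplex-diffs m s 0 w ws point)
    where
    x : Vec ℚ (suc m)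
    x = partialSums 0 (w ∷ ws)

-- s₂ − s₁, …, sₙ₊₁ − sₙ
increments : ∀ {m} → (Fin (suc m) → ℕ) → Fin (suc m) → ℕ
increments {zero}  s zero    = 1
increments {suc m} s zero    = s (suc zero) ∸ s zero
increments {suc m} s (suc i) = increments (s ∘ suc) i

Slow : ∀ {m} → (Fin (suc m) → ℕ) → Set
Slow {m} s = ∀ (i : Fin m) → s (suc i) ≡ s (inject₁ i) ⊎ s (suc i) ≡ suc (s (inject₁ i))

increments≤1 : ∀ {m} {s : Fin (suc m) → ℕ} → Slow s → ∀ i → increments s i ≤ 1
increments≤1 {zero} slow zero = s≤s z≤n
increments≤1 {suc m} {s} slow zero with slow zero
... | inj₁ eq rewrite eq = ℕ.≤-trans (ℕ.≤-reflexive (ℕ.n∸n≡0 (s zero))) z≤n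
... | inj₂ eq rewrite eq = ℕ.≤-reflexive (ℕ.m+n∸n≡m 1 (s zero))
increments≤1 {suc m} slow (suc i) = increments≤1 (slow ∘ suc) i

sum-increments : ∀ {m} {s : Fin (suc m) → ℕ} → Slow s → sum (increments s) + s zero ≡ suc (s (fromℕ m))
sum-increments {zero} slow = refl
sum-increments {suc m} {s} slow = begin
  (d + sum (increments (s ∘ suc))) + s zero ≡⟨ cong (_+ s zero) (ℕ.+-comm d _) ⟩
  (sum (increments (s ∘ suc)) + d) + s zero ≡⟨ ℕ.+-assoc (sum (increments (s ∘ suc))) d (s zero) ⟩
  sum (increments (s ∘ suc)) + (d + s zero) ≡⟨ cong (sum (increments (s ∘ suc)) +_) (ℕ.m∸n+n≡m le) ⟩
  sum (increments (s ∘ suc)) + s (suc zero) ≡⟨ sum-increments (slow ∘ suc) ⟩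
  suc (s (suc (fromℕ m))) ∎
  where
  open ≡-Reasoning
  d : ℕ
  d = s (suc zero) ∸ s zero
  le : s zero ≤ s (suc zero)
  le with slow zero
  ... | inj₁ eq = ℕ.≤-reflexive (sym eq)
  ... | inj₂ eq = ℕ.≤-trans (ℕ.n≤1+n _) (ℕ.≤-reflexive (sym eq))

-- For `b = suc a` and `w = 0` the inequality would read `c * suc a ≤ c * a`, impossible for
-- positive `c`.
increment-≤ : ∀ {a b} → b ≡ a ⊎ b ≡ suc a → ∀ c w → 0 < c → c * b ≤ (c + w) * a → b ∸ a ≤ w
increment-≤ {a} (inj₁ refl) c w       _   _  = ℕ.≤-trans (ℕ.≤-reflexive (ℕ.n∸n≡0 a)) z≤n
increment-≤ {a} (inj₂ refl) c (suc w) _   _  = ℕ.≤-trans (ℕ.≤-reflexive (ℕ.m+n∸n≡m 1 a)) (s≤s z≤n)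
increment-≤ {a} (inj₂ refl) c zero    0<c le = contradiction
  (subst₂ _≤_ (ℕ.*-suc c a) (cong (_* a) (ℕ.+-identityʳ c)) le) (ℕ.<⇒≱ (ℕ.m<n+m (c * a) 0<c))

-- A positive `c` means that some earlier multiplicity is positive, so the second component is the
-- condition of validity for the indices already summed into `c`.
point⇒valid : ∀ {m} {s : Fin (suc m) → ℕ} → Slow s → ∀ {c ws} → LectureHallPoint m s c ws →
  c + sum (Vec.lookup ws) ≡ suc (s (fromℕ m)) ×
  (0 < c → ∀ j → increments s j ≤ Vec.lookup ws j) ×
  (∀ i j → i Fin.< j → 0 < Vec.lookup ws i → increments s j ≤ Vec.lookup ws j)
point⇒valid {zero} slow {c} {w ∷ []} (c≤s , total) =
  trans (cong (c +_) (ℕ.+-identityʳ w)) total ,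
  -- From `c ≤ s zero` and `c + w = suc (s zero)` the last multiplicity is at least 1, the last
  -- increment.
  (λ { _ zero → ℕ.+-cancelˡ-≤ c 1 w (ℕ.≤-trans (ℕ.≤-reflexive (ℕ.+-comm c 1))
                                      (ℕ.≤-trans (s≤s c≤s) (ℕ.≤-reflexive (sym total)))) }) ,
  λ { zero zero () }
point⇒valid {suc m} {s} slow {c} {w ∷ ws} (le , point) =
  let total , started , rest = point⇒valid (slow ∘ suc) {c + w} {ws} point in
  trans (sym (ℕ.+-assoc c w _)) total ,
  (λ { 0<c zero → increment-≤ (slow zero) c w 0<c le ; 0<c (suc j) → started (ℕ.≤-trans 0<c (ℕ.m≤m+n c w)) j }) ,
  λ { zero (suc j) _ 0<w → started (ℕ.≤-trans 0<w (ℕ.m≤n+m w c)) j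
    ; (suc i) (suc j) (s≤s i<j) 0<wi → rest i j i<j 0<wi }

-- The ratios increase to at most 1: the product of `c` with the second term of `s` is at most
-- `(c + w) * s zero`, hence at most the product of the first two terms, and the second term
-- cancels.
point-≤ : ∀ {m} {s : Fin (suc m) → ℕ} → (∀ i → NonZero (s i)) → ∀ {c ws} → LectureHallPoint m s c ws → c ≤ s zero
point-≤ {zero} _ {ws = w ∷ []} (c≤s , _) = c≤s
point-≤ {suc m} {s} s-positive {c} {w ∷ ws} (le , point) =
  ℕ.*-cancelʳ-≤ c (s zero) (s (suc zero)) {{s-positive (suc zero)}}
    (ℕ.≤-trans le (ℕ.≤-trans (ℕ.*-monoˡ-≤ (s zero) (point-≤ (s-positive ∘ suc) point))
                           (ℕ.≤-reflexive (ℕ.*-comm (s (suc zero)) _))))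

valid⇒point : ∀ {m} {s : Fin (suc m) → ℕ} → (∀ i → NonZero (s i)) → Slow s → ∀ {c ws} →
  c + sum (Vec.lookup ws) ≡ suc (s (fromℕ m)) →
  (0 < c → ∀ j → increments s j ≤ Vec.lookup ws j) →
  (∀ i j → i Fin.< j → 0 < Vec.lookup ws i → increments s j ≤ Vec.lookup ws j) →
  LectureHallPoint m s c ws
valid⇒point {zero} s-positive slow {c} {w ∷ []} total started _ = c≤s c started total′ , total′
  where
  total′ : c + w ≡ _
  total′ = trans (cong (c +_) (sym (ℕ.+-identityʳ w))) total
  c≤s : ∀ c → (0 < c → _) → c + w ≡ _ → c ≤ _
  c≤s zero    started eq = z≤n
  c≤s (suc c) started eq = ℕ.≤-pred (ℕ.≤-trans (ℕ.≤-trans (ℕ.≤-reflexive (ℕ.+-comm 1 (suc c)))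
    (ℕ.+-monoʳ-≤ (suc c) (started (s≤s z≤n) zero))) (ℕ.≤-reflexive eq))
valid⇒point {suc m} {s} s-positive slow {c} {w ∷ ws} total started valid = step (slow zero) c started point , point
  where
  point : LectureHallPoint m (s ∘ suc) (c + w) ws
  point = valid⇒point (s-positive ∘ suc) (slow ∘ suc) (trans (ℕ.+-assoc c w _) total) later
            (λ i j i<j → valid (suc i) (suc j) (s≤s i<j))
    where
    later : 0 < c + w → ∀ j → increments (s ∘ suc) j ≤ Vec.lookup ws j
    later 0<c+w j with ℕ.m≤n⇒m<n∨m≡n (z≤n {c})
    ... | inj₁ 0<c = started 0<c (suc j)
    ... | inj₂ refl = valid zero (suc j) (s≤s z≤n) 0<c+w

  step : s (suc zero) ≡ s zero ⊎ s (suc zero) ≡ suc (s zero) →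
         ∀ c → (0 < c → ∀ j → increments s j ≤ Vec.lookup (w ∷ ws) j) →
         LectureHallPoint m (s ∘ suc) (c + w) ws → c * s (suc zero) ≤ (c + w) * s zero
  step (inj₁ eq) c _ _ rewrite eq = ℕ.*-monoˡ-≤ (s zero) (ℕ.m≤m+n c w)
  step (inj₂ eq) zero _ _ = z≤n
  -- As `w ≥ 1`, it suffices that the preceding sum is at most `s zero`. This holds because adding
  -- `w` leaves it at most `suc (s zero)`, by `point-≤` for the tail.
  step (inj₂ eq) (suc c) started point = begin
    suc c * s (suc zero)      ≡⟨ cong (suc c *_) eq ⟩
    suc c * suc (s zero)      ≡⟨ ℕ.*-suc (suc c) (s zero) ⟩
    suc c + suc c * s zero    ≤⟨ ℕ.+-monoˡ-≤ (suc c * s zero) 1+c≤s ⟩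
    suc (suc c) * s zero      ≡⟨ cong (_* s zero) (ℕ.+-comm 1 (suc c)) ⟩
    (suc c + 1) * s zero      ≤⟨ ℕ.*-monoˡ-≤ (s zero) (ℕ.+-monoʳ-≤ (suc c) 1≤w) ⟩
    (suc c + w) * s zero      ∎
    where
    open ℕ.≤-Reasoning
    1≤w : 1 ≤ w
    1≤w = ℕ.≤-trans (ℕ.≤-reflexive (sym (trans (cong (_∸ s zero) eq) (ℕ.m+n∸n≡m 1 (s zero))))) (started (s≤s z≤n) zero)
    1+c≤s : suc c ≤ s zero
    1+c≤s = ℕ.≤-pred (ℕ.≤-trans (ℕ.≤-trans (ℕ.≤-reflexive (ℕ.+-comm 1 (suc c))) (ℕ.+-monoʳ-≤ (suc c) 1≤w))
              (ℕ.≤-trans (point-≤ (s-positive ∘ suc) point) (ℕ.≤-reflexive eq)))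

startIncrements : ∀ {m} → (Fin (suc m) → ℕ) → Fin (suc (suc m)) → ℕ
startIncrements s zero    = 0
startIncrements s (suc i) = increments s i

module Validity {m : ℕ} (s : Fin (suc m) → ℕ) (s-positive : ∀ i → NonZero (s i)) (slow : Slow s) where
  open LectureHall s s-positive

  δ : Fin (suc (suc m)) → ℕ
  δ = startIncrements s

  δ≤1 : ∀ i → δ i ≤ 1
  δ≤1 zero    = z≤n
  δ≤1 (suc i) = increments≤1 slow i

  Σδ<s⁺ : sum δ < s⁺
  Σδ<s⁺ = ℕ.<-≤-trans (ℕ.m<m+n (sum (increments s)) (ℕ.>-nonZero⁻¹ (s zero) {{s-positive zero}}))
                      (ℕ.≤-reflexive (sum-increments slow))

  open Combinatorics δ δ≤1 s⁺ Σδ<s⁺ public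

  abstract
    A⇒valid : ∀ z → A (Vec.map fromℕℚ z) → Valid (Vec.lookup z)
    A⇒valid (w ∷ ws) w∈A =
      let total , started , rest = point⇒valid slow {w} {ws} (A⇒point s s-positive w∈A) in
      total , λ { zero    (suc j) _         0<w → started 0<w j
                ; (suc i) (suc j) (s≤s i<j) 0<z → rest i j i<j 0<z }

    valid⇒A : ∀ z → Valid (Vec.lookup z) → A (Vec.map fromℕℚ z)
    valid⇒A (w ∷ ws) (total , valid) = point⇒A s s-positive {w} {ws}
      (valid⇒point s-positive slow total (λ 0<w j → valid zero (suc j) (s≤s z≤n) 0<w)
                                         (λ i j i<j → valid (suc i) (suc j) (s≤s i<j)))

    -- The membership proof in a multiset is irrelevant, but validity is decidable and can be
    -- recomputed.
    multisets-valid : ∀ I → Valid (Vec.lookup (multiplicities I))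
    multisets-valid (mkMultiset z z∈A) = recompute (valid? _) (A⇒valid z z∈A)

-- The lexicographic term order

++-cancelʳ-↭ : ∀ {V : Set} {u v : List V} w → u ++ w ↭ v ++ w → u ↭ v
++-cancelʳ-↭ {V} {u} {v} w p = cancelˡ w (↭-trans (↭.++-comm w u) (↭-trans p (↭.++-comm v w)))
  where
  cancelˡ : ∀ w → w ++ u ↭ w ++ v → u ↭ v
  cancelˡ []      p = p
  cancelˡ (x ∷ w) p = cancelˡ w (↭.drop-∷ p)

module Minimum {V : Set} {_≈_ _≤_ : Rel V 0ℓ} (isTotalOrder : IsTotalOrder _≈_ _≤_) where
  open IsTotalOrder isTotalOrder using (total) renaming (refl to ≤-refl; trans to ≤-trans)

  minimum : ∀ x xs → ∃ λ y → y ∈ᴸ x ∷ xs × (∀ {z} → z ∈ᴸ x ∷ xs → y ≤ z)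
  minimum x [] = x , here refl , λ { (here refl) → ≤-refl }
  minimum x (x′ ∷ xs) with minimum x′ xs
  ... | y , y∈ , y≤ with total x y
  ...   | inj₁ x≤y = x , here refl , λ { (here refl) → ≤-refl
                                       ; (there z∈) → ≤-trans x≤y (y≤ z∈) }
  ...   | inj₂ y≤x = y , there y∈ , λ { (here refl) → y≤x ; (there z∈) → y≤ z∈ }

module LexTermOrder {V : Set} (_>_ : Rel V 0ℓ) (isStrictTotalOrder : IsStrictTotalOrder _≡_ _>_) where

  open IsStrictTotalOrder isStrictTotalOrder using (compare)

  -- With `_>_` as the strict part of the order, `sort` puts the largest variable first.
  decreasing : DecTotalOrder 0ℓ 0ℓ 0ℓ
  decreasing = record { isDecTotalOrder = NonStrict.isDecTotalOrder _≡_ _>_ isStrictTotalOrder }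

  open DecTotalOrder decreasing public using () renaming (_≤_ to _≥_; _≤?_ to _≥?_; trans to ≥-trans)
  open InsertionSort decreasing public using (insert; sort)
  open InsertionSortProperties decreasing public using (sort-↭; sort-↗; insert-swap)
  open Sorted (DecTotalOrder.totalOrder decreasing) public using (Sorted)

  infix 4 _≤ₗ_ _≼_

  _≤ₗ_ : Rel (List V) 0ℓ
  _≤ₗ_ = Lex-≤ _≡_ (flip _>_)

  -- Comparing decreasing rearrangements is the lexicographic order on exponent vectors. The record
  -- keeps `u` and `v` inferable, which `sort` alone would not.
  record _≼_ (u v : List V) : Set where
    constructor mk≼
    field sort-≤ : sort u ≤ₗ sort v

  open _≼_ public

  ≤ₗ-isTotalOrder : IsTotalOrder (Pointwiseᴸ.Pointwise _≡_) _≤ₗ_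
  ≤ₗ-isTotalOrder = Lexᴸ.≤-isTotalOrder (Flip.isStrictTotalOrder isStrictTotalOrder)

  private module ≤ₗ = IsTotalOrder ≤ₗ-isTotalOrder

  ≱⇒< : ∀ {x y} → ¬ (x ≥ y) → y > x
  ≱⇒< {x} {y} x≱y with compare x y
  ... | tri< x>y _ _ = contradiction (inj₁ x>y) x≱y
  ... | tri≈ _ x≡y _ = contradiction (inj₂ x≡y) x≱y
  ... | tri> _ _ y>x = y>x

  sort-cong-↭ : ∀ {u v} → u ↭ v → sort u ≡ sort v
  sort-cong-↭ ↭.refl          = refl
  sort-cong-↭ (↭.prep x p)    = cong (insert x) (sort-cong-↭ p)
  sort-cong-↭ (↭.swap {ys = v} x y p) = trans (cong (insert x ∘ insert y) (sort-cong-↭ p))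
    (Pointwiseᴸ.Pointwise-≡⇒≡ (insert-swap x y (sort v)))
  sort-cong-↭ (↭.trans p q)   = trans (sort-cong-↭ p) (sort-cong-↭ q)

  sort-injective-↭ : ∀ {u v} → sort u ≡ sort v → u ↭ v
  sort-injective-↭ {u} {v} eq = ↭-trans (↭-sym (sort-↭ u)) (subst (_↭ v) (sym eq) (sort-↭ v))

  sort-sorted : ∀ {u} → Sorted u → sort u ≡ u
  sort-sorted []  = refl
  sort-sorted [-] = refl
  sort-sorted {x ∷ y ∷ u} (x≥y ∷ s) rewrite sort-sorted s with x ≥? y
  ... | yes _  = refl
  ... | no x≱y = contradiction x≥y x≱y

  -- Compatibility with multiplication, one variable at a time: `z` lands on the same side of the
  -- first difference in both lists, or it becomes the smaller entry at that place itself.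
  insert-mono : ∀ z {u v} → u ≤ₗ v → insert z u ≤ₗ insert z v
  insert-mono z (base tt) = ≤ₗ.refl
  insert-mono z (halt {y}) with z ≥? y
  ... | yes _  = next refl halt
  ... | no z≱y = this (≱⇒< z≱y)
  insert-mono z (this {x} {_} {y} y>x) with z ≥? x | z ≥? y
  ... | yes _  | yes _   = next refl (this y>x)
  ... | yes _  | no z≱y  = this (≱⇒< z≱y)
  ... | no z≱x | yes z≥y = contradiction (≥-trans z≥y (inj₁ y>x)) z≱x
  ... | no _   | no _    = this y>x
  insert-mono z (next {x} refl u≤v) with z ≥? x
  ... | yes _ = next refl (next refl u≤v)
  ... | no  _ = next refl (insert-mono z u≤v)

  ++-mono : ∀ w {u v} → u ≼ v → w ++ u ≼ w ++ v
  ++-mono []      u≼v = u≼v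
  ++-mono (z ∷ w) u≼v = mk≼ (insert-mono z (sort-≤ (++-mono w u≼v)))

  ≼-isTotalOrder : IsTotalOrder _↭_ _≼_
  ≼-isTotalOrder = record
    { isPartialOrder = record
      { isPreorder = record
        { isEquivalence = ↭-isEquivalence
        ; reflexive     = λ p → mk≼ (≤ₗ.reflexive (Pointwiseᴸ.≡⇒Pointwise-≡ (sort-cong-↭ p)))
        ; trans         = λ (mk≼ u≤v) (mk≼ v≤w) → mk≼ (≤ₗ.trans u≤v v≤w)
        }
      ; antisym = λ (mk≼ u≤v) (mk≼ v≤u) → sort-injective-↭ (Pointwiseᴸ.Pointwise-≡⇒≡ (≤ₗ.antisym u≤v v≤u))
      }
    ; total = λ u v → Sum.map mk≼ mk≼ (≤ₗ.total (sort u) (sort v))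
    }

  lexTermOrder : TermOrder V
  lexTermOrder = record
    { _≼_          = _≼_
    ; isTotalOrder = ≼-isTotalOrder
    ; compatible   = λ {u} {v} w u≼v →
        mk≼ (subst₂ _≤ₗ_ (sort-cong-↭ (↭.++-comm w u)) (sort-cong-↭ (↭.++-comm w v)) (sort-≤ (++-mono w u≼v)))
    ; 1-smallest   = λ u → mk≼ (1≤ (sort u))
    }
    where
    1≤ : ∀ u → [] ≤ₗ u
    1≤ []      = base tt
    1≤ (_ ∷ _) = halt

-- Least collections with a given union

lex⇒⊐ : ∀ {n} {x y : Vec ℕ n} → Lex-< _≡_ ℕ._>_ x y → Vec.lookup x ⊐ Vec.lookup y
lex⇒⊐ (this x>y _) = zero , (λ _ ()) , x>y
lex⇒⊐ (next refl x>y) with lex⇒⊐ x>y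
... | a , eq , y<x = suc a , (λ { zero _ → refl ; (suc i) (s≤s i<a) → eq i i<a }) , y<x

⊐⇒lex : ∀ {n} {x y : Vec ℕ n} → Vec.lookup x ⊐ Vec.lookup y → Lex-< _≡_ ℕ._>_ x y
⊐⇒lex {x = _ ∷ _} {_ ∷ _} (zero  , eq , y<x) = this y<x refl
⊐⇒lex {x = _ ∷ _} {_ ∷ _} (suc a , eq , y<x) =
  next (eq zero (s≤s z≤n)) (⊐⇒lex (a , (λ i i<a → eq (suc i) (s≤s i<a)) , y<x))

lookup≤sum : ∀ {n} (f : Fin n → ℕ) i → f i ≤ sum f
lookup≤sum f zero    = ℕ.m≤m+n (f zero) _
lookup≤sum f (suc i) = ℕ.≤-trans (lookup≤sum (f ∘ suc) i) (ℕ.m≤n+m _ (f zero))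

-- These enumerations make the fibres finite, so that least elements can be computed and leastness
-- decided.
boundedVecs : ∀ n → ℕ → List (Vec ℕ n)
boundedVecs zero    b = [] ∷ []
boundedVecs (suc n) b = cartesianProductWith _∷_ (upTo (suc b)) (boundedVecs n b)

∈-boundedVecs : ∀ {n b} (z : Vec ℕ n) → (∀ i → Vec.lookup z i ≤ b) → z ∈ᴸ boundedVecs n b
∈-boundedVecs []      _   = here refl
∈-boundedVecs (w ∷ z) z≤b = ∈-cartesianProductWith⁺ _∷_ (∈-upTo⁺ (s≤s (z≤b zero))) (∈-boundedVecs z (z≤b ∘ suc))

words : ∀ {V : Set} → List V → ℕ → List (List V)
words xs zero    = [] ∷ []
words xs (suc k) = cartesianProductWith _∷_ xs (words xs k)

∈-words : ∀ {V : Set} {xs : List V} → (∀ x → x ∈ᴸ xs) → ∀ u → u ∈ᴸ words xs (length u)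
∈-words ∈xs []      = here refl
∈-words ∈xs (x ∷ u) = ∈-cartesianProductWith⁺ _∷_ (∈xs x) (∈-words ∈xs u)

AllPairs-lookup : ∀ {V : Set} {R : V → V → Set} {u} → AllPairs R u →
                  ∀ {r t} → r Fin.< t → R (List.lookup u r) (List.lookup u t)
AllPairs-lookup (px ∷ pxs) {zero}  {suc t} _         = All.lookup px (∈-lookup t)
AllPairs-lookup (px ∷ pxs) {suc r} {suc t} (s≤s r<t) = AllPairs-lookup pxs r<t

sum-lookup : ∀ {V : Set} (f : V → ℕ) u → sum (λ r → f (List.lookup u r)) ≡ sumᴸ (List.map f u)
sum-lookup f []      = refl
sum-lookup f (x ∷ u) = cong (f x +_) (sum-lookup f u)

-- A failing pair is brought to the front, so that the remaining variables form its cofactor.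
allPairs⊎¬ : ∀ {V : Set} {R : V → V → Set} → (∀ x y → Dec (R x y)) → ∀ u →
             AllPairs R u ⊎ (∃₂ λ x y → ∃ λ w → u ↭ x ∷ y ∷ w × ¬ R x y)
allPairs⊎¬ R? [] = inj₁ []
allPairs⊎¬ R? (x ∷ u) with All.all? (R? x) u | allPairs⊎¬ R? u
... | yes px | inj₁ pu = inj₁ (px ∷ pu)
... | _      | inj₂ (y , z , w , u↭ , ¬R) =
  inj₂ (y , z , x ∷ w , ↭-trans (prep x u↭) (↭-trans (↭.swap x y ↭-refl) (prep y (↭.swap x z ↭-refl))) , ¬R)
... | no ¬px | inj₁ _ with find (All.¬All⇒Any¬ (R? x) u ¬px)
...   | y , y∈u , ¬Rxy with ∈-∃++ y∈u
...     | as , bs , refl = inj₂ (x , y , as ++ bs , prep x (↭.shift y as bs) , ¬Rxy)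

module Fibres {m : ℕ} (s : Fin (suc m) → ℕ) (s-positive : ∀ i → NonZero (s i)) (slow : Slow s) where
  open LectureHall s s-positive
  open Validity s s-positive slow

  multiplicities-injective : ∀ {I J} → multiplicities I ≡ multiplicities J → I ≡ J
  multiplicities-injective {mkMultiset _ _} {mkMultiset _ _} refl = refl

  ≻-isStrictTotalOrder : IsStrictTotalOrder _≡_ _≻ˡᵉˣ_
  ≻-isStrictTotalOrder = record
    { isStrictPartialOrder = record
      { isEquivalence = isEquivalence
      ; irrefl        = λ { refl → O.irrefl (Pointwiseⱽ.≡⇒Pointwise-≡ refl) }
      ; trans         = O.trans
      ; <-resp-≈      = resp₂ _≻ˡᵉˣ_
      }
    ; compare = λ I J → compare I J (O.compare (multiplicities I) (multiplicities J))
    }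
    where
    module O = IsStrictTotalOrder (Lexⱽ.<-isStrictTotalOrder (Flip.isStrictTotalOrder ℕ.<-isStrictTotalOrder) {suc (suc m)})
    compare : ∀ I J → Tri _ _ _ → Tri (I ≻ˡᵉˣ J) (I ≡ J) (J ≻ˡᵉˣ I)
    compare I J (tri< I≻J I≉J J⊁I) = tri< I≻J (λ { refl → I≉J (Pointwiseⱽ.≡⇒Pointwise-≡ refl) }) J⊁I
    compare I J (tri≈ I⊁J I≈J J⊁I) = tri≈ I⊁J (multiplicities-injective (Pointwiseⱽ.Pointwise-≡⇒≡ I≈J)) J⊁I
    compare I J (tri> I⊁J I≉J J≻I) = tri> I⊁J (λ { refl → I≉J (Pointwiseⱽ.≡⇒Pointwise-≡ refl) }) J≻I

  open LexTermOrder _≻ˡᵉˣ_ ≻-isStrictTotalOrder public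
  open IsStrictTotalOrder ≻-isStrictTotalOrder public using () renaming (irrefl to ≻-irrefl; asym to ≻-asym)
  module ≼ = IsTotalOrder ≼-isTotalOrder

  private V = LectureHallMultiset

  row : V → Fin (suc (suc m)) → ℕ
  row I = Vec.lookup (multiplicities I)

  fromValid : (z : Fin (suc (suc m)) → ℕ) → Valid z → V
  fromValid z (Σz , v) = mkMultiset (Vec.tabulate z)
    (valid⇒A (Vec.tabulate z) (trans (sum-cong-≗ (Vec.lookup∘tabulate z)) Σz , v′))
    where
    v′ : ∀ i j → i Fin.< j → 0 < Vec.lookup (Vec.tabulate z) i → δ j ≤ Vec.lookup (Vec.tabulate z) j
    v′ i j i<j rewrite Vec.lookup∘tabulate z i | Vec.lookup∘tabulate z j = v i j i<j

  fromVec : Vec ℕ (suc (suc m)) → List V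
  fromVec z with valid? (Vec.lookup z)
  ... | yes v = mkMultiset z (valid⇒A z v) ∷ []
  ... | no  _ = []

  allMultisets : List V
  allMultisets = concatMap fromVec (boundedVecs (suc (suc m)) s⁺)

  ∈-allMultisets : ∀ I → I ∈ᴸ allMultisets
  ∈-allMultisets I = ∈-concatMap⁺ fromVec (lose (∈-boundedVecs (multiplicities I) bounded) ∈fromVec)
    where
    bounded : ∀ i → row I i ≤ s⁺
    bounded i = ℕ.≤-trans (lookup≤sum (row I) i) (ℕ.≤-reflexive (proj₁ (multisets-valid I)))
    ∈fromVec : I ∈ᴸ fromVec (multiplicities I)
    ∈fromVec with valid? (row I)
    ... | yes v = here refl
    ... | no ¬v = contradiction (multisets-valid I) ¬v

  column : List V → Fin (suc (suc m)) → ℕ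
  column u i = sumᴸ (List.map (λ I → row I i) u)

  infix 4 _~_
  -- The fibres of the toric map on monomials: equal degree and equal union.
  record _~_ (u v : List V) : Set where
    constructor mk~
    field
      length≡ : length u ≡ length v
      column≗ : column u ≗ column v

  abstract
    _~?_ : ∀ u v → Dec (u ~ v)
    u ~? v = map′ (λ (l , c) → mk~ l c) (λ (mk~ l c) → l , c)
      ((length u ℕ.≟ length v) ×-dec Fin.all? λ i → column u i ℕ.≟ column v i)

  ~-sym : ∀ {u v} → u ~ v → v ~ u
  ~-sym (mk~ l c) = mk~ (sym l) (sym ∘ c)

  ~-trans : ∀ {u v w} → u ~ v → v ~ w → u ~ w
  ~-trans (mk~ l c) (mk~ l′ c′) = mk~ (trans l l′) λ i → trans (c i) (c′ i)

  ↭⇒~ : ∀ {u v} → u ↭ v → u ~ v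
  ↭⇒~ p = mk~ (↭.↭-length p) λ i → sum-↭ (↭.map⁺ (λ I → row I i) p)

  column-++ : ∀ u w i → column (u ++ w) i ≡ column u i + column w i
  column-++ u w i = trans (cong sumᴸ (List.map-++ (λ I → row I i) u w)) (sum-++ (List.map (λ I → row I i) u) _)

  ~-++ʳ : ∀ w {u v} → u ~ v → u ++ w ~ v ++ w
  ~-++ʳ w {u} {v} (mk~ l c) = mk~
    (trans (List.length-++ u) (trans (cong (_+ length w) l) (sym (List.length-++ v))))
    λ i → trans (column-++ u w i) (trans (cong (_+ column w i) (c i)) (sym (column-++ v w i)))

  LeastInFibre : List V → Set
  LeastInFibre u = ∀ v → v ~ u → u ≼ v

  least-resp-↭ : ∀ {u v} → u ↭ v → LeastInFibre u → LeastInFibre v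
  least-resp-↭ u↭v least w w~v = ≼.trans (≼.reflexive (↭-sym u↭v)) (least w (~-trans w~v (↭⇒~ (↭-sym u↭v))))

  abstract
    -- The fibre is found among the finitely many words of the same length; `u` itself makes it
    -- nonempty.
    fibre-minimum : ∀ u → ∃ λ v → v ~ u × LeastInFibre v
    fibre-minimum u with minimum u (List.filter (_~? u) (words allMultisets (length u)))
      where open Minimum ≼-isTotalOrder
    ... | v , v∈ , v≼ = v , v~u , λ w w~v → v≼ (there (∈-filter⁺ (_~? u) (∈w (~-trans w~v v~u)) (~-trans w~v v~u)))
      where
      ∈w : ∀ {w} → w ~ u → w ∈ᴸ words allMultisets (length u)
      ∈w {w} (mk~ l _) = subst (λ k → w ∈ᴸ words allMultisets k) l (∈-words ∈-allMultisets w)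
      ∈⇒~ : ∀ {w} → w ∈ᴸ u ∷ List.filter (_~? u) (words allMultisets (length u)) → w ~ u
      ∈⇒~ (here refl) = ↭⇒~ ↭-refl
      ∈⇒~ (there w∈)  = proj₂ (∈-filter⁻ (_~? u) {xs = words allMultisets (length u)} w∈)
      v~u : v ~ u
      v~u = ∈⇒~ v∈

    least? : ∀ u → Dec (LeastInFibre u)
    least? u with fibre-minimum u
    ... | v , v~u , v-least = map′ (λ u↭v → least-resp-↭ (↭-sym u↭v) v-least)
        (λ u-least → ≼.antisym (u-least v v~u) (v-least u (~-sym v~u))) (↭-dec _≟_ u v)

  LeastPair : V → V → Set
  LeastPair I J = LeastInFibre (I ∷ J ∷ [])

  -- A smaller monomial in the fibre of the pair, multiplied by `w`, would undercut `u`; equality of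
  -- the products cancels to equality of the pairs.
  leastPair : ∀ {u I J} w → LeastInFibre u → u ↭ I ∷ J ∷ w → LeastPair I J
  leastPair {u} {I} {J} w least u↭ v v~IJ with ≼.total (I ∷ J ∷ []) v
  ... | inj₁ IJ≼v = IJ≼v
  ... | inj₂ v≼IJ = ≼.reflexive (++-cancelʳ-↭ w (≼.antisym IJw≼vw (TermOrder.compatible lexTermOrder w v≼IJ)))
    where
    IJw≼vw : I ∷ J ∷ w ≼ v ++ w
    IJw≼vw = least-resp-↭ u↭ least (v ++ w) (~-++ʳ w v~IJ)

  -- Both new members are smaller than `I`, so whichever of them is sorted first, the new pair lies
  -- below the least one.
  leastPair⇒irreducible : ∀ {I J} → I ≥ J → LeastPair I J → Irreducible (row I) (row J)
  leastPair⇒irreducible {I} {J} I≥J least I′ J′ I′-valid J′-valid union≡ I⊐I′ I⊐J′ =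
    absurd (subst (_≤ₗ sort (K ∷ L ∷ [])) (sort-sorted (I≥J ∷ [-])) (sort-≤ (least (K ∷ L ∷ []) (mk~ refl same))))
    where
    K L : V
    K = fromValid I′ I′-valid
    L = fromValid J′ J′-valid

    same : column (K ∷ L ∷ []) ≗ column (I ∷ J ∷ [])
    same i rewrite Vec.lookup∘tabulate I′ i | Vec.lookup∘tabulate J′ i
                 | ℕ.+-identityʳ (J′ i) | ℕ.+-identityʳ (row J i) = union≡ i

    I≻ : ∀ {z} (z-valid : Valid z) → row I ⊐ z → I ≻ˡᵉˣ fromValid z z-valid
    I≻ {z} _ (a , eq , z<I) = ⊐⇒lex (a , (λ i i<a → trans (eq i i<a) (sym (Vec.lookup∘tabulate z i))) ,
                                     subst (_< row I a) (sym (Vec.lookup∘tabulate z a)) z<I)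

    ≰ : ∀ {x u v} → I ≻ˡᵉˣ x → ¬ (I ∷ u ≤ₗ x ∷ v)
    ≰ {x} I≻x (this x≻I) = ≻-asym {I} {x} I≻x x≻I
    ≰ I≻x (next I≡x _) = ≻-irrefl I≡x I≻x

    absurd : ¬ (I ∷ J ∷ [] ≤ₗ sort (K ∷ L ∷ []))
    absurd le with K ≥? L
    ... | yes _ = ≰ (I≻ I′-valid I⊐I′) le
    ... | no  _ = ≰ (I≻ J′-valid I⊐J′) le

  -- A separate `k` lets two lists of equal length share the index type `Fin k`.
  rows : ∀ {k} (u : List V) → length u ≡ k → Fin k → V
  rows u refl = List.lookup u

  tabulate-rows : ∀ {k} (u : List V) (l : length u ≡ k) → List.tabulate (rows u l) ≡ u
  tabulate-rows u refl = List.tabulate-lookup u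

  rows-column : ∀ {k} (u : List V) (l : length u ≡ k) i → sum (λ r → row (rows u l r) i) ≡ column u i
  rows-column u refl i = sum-lookup (λ I → row I i) u

  rows-reduced : ∀ {k} {u : List V} (l : length u ≡ k) → Sorted u → AllPairs LeastPair u →
                 IsReducedFamily (λ r → row (rows u l r))
  rows-reduced {u = u} refl sorted pairs = record
    { valid       = λ r → multisets-valid (List.lookup u r)
    ; sorted      = λ r<t → ≥⇒⊒ (AllPairs-lookup decreasing-pairs r<t)
    ; irreducible = λ r<t → leastPair⇒irreducible (AllPairs-lookup decreasing-pairs r<t) (AllPairs-lookup pairs r<t)
    }
    where
    decreasing-pairs : AllPairs _≥_ u
    decreasing-pairs = Linked⇒AllPairs ≥-trans sorted
    ≥⇒⊒ : ∀ {I J} → I ≥ J → row I ⊒ row J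
    ≥⇒⊒ (inj₁ I≻J) = inj₁ (lex⇒⊐ I≻J)
    ≥⇒⊒ (inj₂ refl) = inj₂ λ _ → refl

  leastPairs-unique : ∀ {u v} → Sorted u → Sorted v → AllPairs LeastPair u → AllPairs LeastPair v → u ~ v → u ≡ v
  leastPairs-unique {u} {v} u↗ v↗ u-pairs v-pairs (mk~ l c) = begin
    u                               ≡⟨ tabulate-rows u l ⟨
    List.tabulate (rows u l)        ≡⟨ List.tabulate-cong rows≡ ⟩
    List.tabulate (rows v refl)     ≡⟨ tabulate-rows v refl ⟩
    v                               ∎
    where
    open ≡-Reasoning
    entries≡ : ∀ i r → row (rows u l r) i ≡ row (rows v refl r) i
    entries≡ = reduced-unique (rows-reduced l u↗ u-pairs) (rows-reduced refl v↗ v-pairs)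
      (λ i → trans (rows-column u l i) (trans (c i) (sym (rows-column v refl i))))
    rows≡ : ∀ r → rows u l r ≡ rows v refl r
    rows≡ r = multiplicities-injective (begin
      multiplicities (rows u l r)        ≡⟨ Vec.tabulate∘lookup _ ⟨
      Vec.tabulate (row (rows u l r))    ≡⟨ Vec.tabulate-cong (λ i → entries≡ i r) ⟩
      Vec.tabulate (row (rows v refl r)) ≡⟨ Vec.tabulate∘lookup _ ⟩
      multiplicities (rows v refl r)     ∎)

  -- If all pairs of `u` are least, then `u` and the minimum of its fibre both have this property,
  -- and `leastPairs-unique` identifies them.
  least⊎¬leastPair : ∀ u → LeastInFibre u ⊎ (∃₂ λ I J → ∃ λ w → u ↭ I ∷ J ∷ w × ¬ LeastPair I J)
  least⊎¬leastPair u with allPairs⊎¬ (λ I J → least? (I ∷ J ∷ [])) (sort u)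
  ... | inj₂ (I , J , w , ↭IJw , ¬least) = inj₂ (I , J , w , ↭-trans (↭-sym (sort-↭ u)) ↭IJw , ¬least)
  ... | inj₁ u-pairs with fibre-minimum u
  ...   | v , v~u , v-least with allPairs⊎¬ (λ I J → least? (I ∷ J ∷ [])) (sort v)
  ...     | inj₂ (I , J , w , ↭IJw , ¬least) =
            contradiction (leastPair w v-least (↭-trans (↭-sym (sort-↭ v)) ↭IJw)) ¬least
  ...     | inj₁ v-pairs = inj₁ (least-resp-↭ (sort-injective-↭ (leastPairs-unique (sort-↗ v) (sort-↗ u) v-pairs u-pairs
              (~-trans (↭⇒~ (sort-↭ v)) (~-trans v~u (↭⇒~ (↭-sym (sort-↭ u))))))) v-least)

-- Minimal collections as least monomials

module Collections {m : ℕ} (s : Fin (suc m) → ℕ) (s-positive : ∀ i → NonZero (s i)) (slow : Slow s) where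
  open LectureHall s s-positive
  open Fibres s s-positive slow

  private V = LectureHallMultiset

  lookup-union : ∀ {k} (𝓘 : Collection k) i → Vec.lookup (union 𝓘) i ≡ column (collectionMonomial 𝓘) i
  lookup-union 𝓘 = go (members 𝓘)
    where
    go : ∀ {k} (xs : Vec V k) i →
         Vec.lookup (Vec.foldr′ (Vec.zipWith _+_) (Vec.replicate _ 0) (Vec.map multiplicities xs)) i ≡
         column (Vec.toList xs) i
    go []       i = Vec.lookup-replicate i 0
    go (x ∷ xs) i = trans (Vec.lookup-zipWith _+_ i (multiplicities x) _) (cong (row x i +_) (go xs i))

  union⇒~ : ∀ {k} (𝓘 𝓙 : Collection k) → union 𝓘 ≡ union 𝓙 → collectionMonomial 𝓘 ~ collectionMonomial 𝓙
  union⇒~ 𝓘 𝓙 eq = mk~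
    (trans (Vec.length-toList (members 𝓘)) (sym (Vec.length-toList (members 𝓙))))
    λ i → trans (sym (lookup-union 𝓘 i)) (trans (cong (λ z → Vec.lookup z i) eq) (lookup-union 𝓙 i))

  ~⇒union : ∀ {k} (𝓘 𝓙 : Collection k) → collectionMonomial 𝓘 ~ collectionMonomial 𝓙 → union 𝓘 ≡ union 𝓙
  ~⇒union 𝓘 𝓙 (mk~ _ c) = begin
    union 𝓘                              ≡⟨ Vec.tabulate∘lookup _ ⟨
    Vec.tabulate (Vec.lookup (union 𝓘))  ≡⟨ Vec.tabulate-cong (λ i → trans (lookup-union 𝓘 i) (trans (c i) (sym (lookup-union 𝓙 i)))) ⟩
    Vec.tabulate (Vec.lookup (union 𝓙))  ≡⟨ Vec.tabulate∘lookup _ ⟩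
    union 𝓙                              ∎
    where open ≡-Reasoning

  collectionMonomial-sorted : ∀ {k} (𝓘 : Collection k) → Sorted (collectionMonomial 𝓘)
  collectionMonomial-sorted 𝓘 = go (sorted 𝓘)
    where
    go : ∀ {k} {xs : Vec V k} → Linked _≽ˡᵉˣ_ xs → Sorted (Vec.toList xs)
    go []                         = []
    go [-]                        = [-]
    go (_∷_ {xs = _ ∷ _} x≽y xs↗) = x≽y ∷ go xs↗

  sortedCollection : ∀ {k} u → length u ≡ k → ∃ λ (𝓘 : Collection k) → collectionMonomial 𝓘 ≡ sort u
  sortedCollection u refl = subst (λ k → ∃ λ (𝓘 : Collection k) → collectionMonomial 𝓘 ≡ sort u) (↭.↭-length (sort-↭ u))
    (mkCollection (Vec.fromList (sort u)) (go (sort-↗ u)) , Vec.toList∘fromList (sort u))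
    where
    go : ∀ {v} → Sorted v → Linked _≽ˡᵉˣ_ (Vec.fromList v)
    go []          = []
    go [-]         = [-]
    go (x≽y ∷ v↗) = x≽y ∷ go v↗

  ≻ᶜ⇒≤ₗ : ∀ {k} {xs ys : Vec V k} → Lex-< _≡_ _≻ˡᵉˣ_ xs ys → Vec.toList ys ≤ₗ Vec.toList xs
  ≻ᶜ⇒≤ₗ (this x≻y _)     = this x≻y
  ≻ᶜ⇒≤ₗ (next refl xs≻ys) = next refl (≻ᶜ⇒≤ₗ xs≻ys)

  ≤ₗ⇒≻ᶜ : ∀ {k} {xs ys : Vec V k} → Vec.toList ys ≤ₗ Vec.toList xs → ¬ xs ≡ ys → Lex-< _≡_ _≻ˡᵉˣ_ xs ys
  ≤ₗ⇒≻ᶜ {xs = []}     {[]}     _                 xs≢ys = contradiction refl xs≢ys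
  ≤ₗ⇒≻ᶜ {xs = _ ∷ _}  {_ ∷ _}  (this x≻y)        xs≢ys = this x≻y refl
  ≤ₗ⇒≻ᶜ {xs = x ∷ _}  {_ ∷ _}  (next refl ys≤xs) xs≢ys = next refl (≤ₗ⇒≻ᶜ ys≤xs (xs≢ys ∘ cong (x ∷_)))

  least⇒minimal : ∀ {k} (𝓘 : Collection k) → LeastInFibre (collectionMonomial 𝓘) → Minimal 𝓘
  least⇒minimal 𝓘 least 𝓙 𝓙≢𝓘 eq = ≤ₗ⇒≻ᶜ
    (subst₂ _≤ₗ_ (sort-sorted (collectionMonomial-sorted 𝓘)) (sort-sorted (collectionMonomial-sorted 𝓙))
      (sort-≤ (least (collectionMonomial 𝓙) (union⇒~ 𝓙 𝓘 eq)))) 𝓙≢𝓘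

  minimal⇒least : ∀ {k} (𝓘 : Collection k) → Minimal 𝓘 → LeastInFibre (collectionMonomial 𝓘)
  minimal⇒least {k} 𝓘 minimal v v~𝓘 =
    let 𝓙 , 𝓙≡v = sortedCollection v (trans (_~_.length≡ v~𝓘) (Vec.length-toList (members 𝓘)))
        𝓙~𝓘 = ~-trans (↭⇒~ (↭-trans (↭-reflexive 𝓙≡v) (sort-↭ v))) v~𝓘
    in ≼.trans (𝓘≼ 𝓙 (~⇒union 𝓙 𝓘 𝓙~𝓘)) (≼.reflexive (↭-trans (↭-reflexive 𝓙≡v) (sort-↭ v)))
    where
    𝓘≼ : ∀ (𝓙 : Collection k) → union 𝓙 ≡ union 𝓘 → collectionMonomial 𝓘 ≼ collectionMonomial 𝓙
    𝓘≼ 𝓙 eq with Vec.≡-dec _≟_ (members 𝓙) (members 𝓘)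
    ... | yes 𝓙≡𝓘 = ≼.reflexive (↭-reflexive (cong Vec.toList (sym 𝓙≡𝓘)))
    ... | no  𝓙≢𝓘 = mk≼ (subst₂ _≤ₗ_ (sym (sort-sorted (collectionMonomial-sorted 𝓘)))
                                      (sym (sort-sorted (collectionMonomial-sorted 𝓙))) (≻ᶜ⇒≤ₗ (minimal 𝓙 𝓙≢𝓘 eq)))

  minimalCollection : ∀ {k} (𝓘 : Collection k) → ∃ λ (𝓘⁻ : Collection k) → Minimal 𝓘⁻ × union 𝓘⁻ ≡ union 𝓘
  minimalCollection 𝓘 =
    let v , v~𝓘 , v-least = fibre-minimum (collectionMonomial 𝓘)
        𝓙 , 𝓙≡v = sortedCollection v (trans (_~_.length≡ v~𝓘) (Vec.length-toList (members 𝓘)))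
        𝓙↭v = ↭-trans (↭-reflexive 𝓙≡v) (sort-↭ v)
    in 𝓙 , least⇒minimal 𝓙 (least-resp-↭ (↭-sym 𝓙↭v) v-least) , ~⇒union 𝓙 𝓘 (~-trans (↭⇒~ 𝓙↭v) v~𝓘)

  -- This gives square-freeness. If two multisets have union twice `I`, the larger cannot lie below
  -- `I`: where it first falls short of `I`, the other would exceed it.
  leastPair-refl : ∀ I → LeastPair I I
  leastPair-refl I v v~II = mk≼ (subst (_≤ₗ sort v) (sym (sort-sorted (inj₂ refl ∷ [-])))
    (go (sort v) (sort-↗ v) (~-trans (↭⇒~ (sort-↭ v)) v~II)))
    where
    go : ∀ u → Sorted u → u ~ I ∷ I ∷ [] → I ∷ I ∷ [] ≤ₗ u
    go []                 _ (mk~ () _)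
    go (_ ∷ [])           _ (mk~ () _)
    go (_ ∷ _ ∷ _ ∷ _)    _ (mk~ () _)
    go (A ∷ B ∷ []) (A≥B ∷ [-]) (mk~ _ columns) = compare′ (IsStrictTotalOrder.compare ≻-isStrictTotalOrder A I)
      where
      A+B≡I+I : ∀ i → row A i + row B i ≡ row I i + row I i
      A+B≡I+I i = trans (cong (row A i +_) (sym (ℕ.+-identityʳ _))) (trans (columns i) (cong (row I i +_) (ℕ.+-identityʳ _)))

      compare′ : _ → I ∷ I ∷ [] ≤ₗ A ∷ B ∷ []
      compare′ (tri< A≻I _ _)  = this A≻I
      compare′ (tri≈ _ refl _) = next refl (next (sym B≡I) (base tt))
        where
        B≡I : B ≡ I
        B≡I = multiplicities-injective (trans (sym (Vec.tabulate∘lookup _))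
          (trans (Vec.tabulate-cong (λ i → ℕ.+-cancelˡ-≡ (row I i) _ _ (A+B≡I+I i))) (Vec.tabulate∘lookup _)))
      compare′ (tri> _ _ I≻A) with lex⇒⊐ I≻A
      ... | a , I≡A , Aa<Ia = contradiction B≻A (A⊁B A≥B)
        where
        A⊁B : A ≥ B → ¬ B ≻ˡᵉˣ A
        A⊁B (inj₁ A≻B) B≻A = ≻-asym {A} {B} A≻B B≻A
        A⊁B (inj₂ A≡B) B≻A = ≻-irrefl (sym A≡B) B≻A
        Ba>Aa : row A a < row B a
        Ba>Aa = ℕ.≰⇒> λ Ba≤Aa → contradiction (A+B≡I+I a)
          (ℕ.<⇒≢ (ℕ.+-mono-< Aa<Ia (ℕ.≤-<-trans Ba≤Aa Aa<Ia)))
        B≻A : B ≻ˡᵉˣ A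
        B≻A = ⊐⇒lex (a , (λ i i<a → ℕ.+-cancelˡ-≡ (row A i) _ _
                (trans (A+B≡I+I i) (cong₂ _+_ (I≡A i i<a) (I≡A i i<a)))) , Ba>Aa)

  underlined-unique : ∀ {u} → UnderlinedTerms u → Unique u
  underlined-unique (mkCollection (I ∷ J ∷ []) IJ↘ , ¬minimal , refl) = (I≢J ∷ []) ∷ [] ∷ []
    where
    I≢J : ¬ I ≡ J
    I≢J refl = ¬minimal (least⇒minimal (mkCollection (I ∷ I ∷ []) IJ↘) (leastPair-refl I))

-- The toric ideal

lookup-∷ʳ-inject₁ : ∀ {A : Set} {n} (xs : Vec A n) x i → Vec.lookup (xs ∷ʳ x) (inject₁ i) ≡ Vec.lookup xs i
lookup-∷ʳ-inject₁ (_ ∷ xs) x zero    = refl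
lookup-∷ʳ-inject₁ (_ ∷ xs) x (suc i) = lookup-∷ʳ-inject₁ xs x i

lookup-∷ʳ-fromℕ : ∀ {A : Set} {n} (xs : Vec A n) x → Vec.lookup (xs ∷ʳ x) (fromℕ n) ≡ x
lookup-∷ʳ-fromℕ []       x = refl
lookup-∷ʳ-fromℕ (_ ∷ xs) x = lookup-∷ʳ-fromℕ xs x

module ToricGröbner {m : ℕ} (s : Fin (suc m) → ℕ) (s-positive : ∀ i → NonZero (s i)) (slow : Slow s)
                    {c ℓ₁ ℓ₂ : Level} (K : HeytingField c ℓ₁ ℓ₂) where

  open LectureHall s s-positive
  open Fibres s s-positive slow
  open Collections s s-positive slow
  open Polynomials K _≟_ hiding (_+_; _*_; sum)
  open MonomialIdeals K _≟_

  private
    V = LectureHallMultiset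
    module K = HeytingField K
    module L where
      open LaurentPolynomials K (suc (suc (suc m))) public
      open MonoidAlgebraProperties K
        (Pointwise.commutativeMonoid (Fin (suc (suc (suc m)))) ℤ.+-0-commutativeMonoid)
        (λ x y → Fin.all? λ i → x i ℤ.≟ y i) public

  -- The exponent vector of the image of a monomial. Its last coordinate counts the degree, which
  -- makes equality of exponents the relation `_~_`.
  exponents : List V → Fin (suc (suc (suc m))) → ℤ
  exponents []      _ = ℤ.+ 0
  exponents (I ∷ u) i = Vec.lookup (Vec.map ℤ.+_ (multiplicities I) ∷ʳ ℤ.+ 1) i ℤ.+ exponents u i

  exponents-inject₁ : ∀ u i → exponents u (inject₁ i) ≡ ℤ.+ column u i
  exponents-inject₁ []      i = refl
  exponents-inject₁ (I ∷ u) i = cong₂ ℤ._+_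
    (trans (lookup-∷ʳ-inject₁ (Vec.map ℤ.+_ (multiplicities I)) _ i) (Vec.lookup-map i ℤ.+_ (multiplicities I)))
    (exponents-inject₁ u i)

  exponents-fromℕ : ∀ u → exponents u (fromℕ (suc (suc m))) ≡ ℤ.+ length u
  exponents-fromℕ []      = refl
  exponents-fromℕ (I ∷ u) = cong₂ ℤ._+_ (lookup-∷ʳ-fromℕ (Vec.map ℤ.+_ (multiplicities I)) (ℤ.+ 1)) (exponents-fromℕ u)

  exponents⇒~ : ∀ {u v} → exponents u ≗ exponents v → u ~ v
  exponents⇒~ {u} {v} eq = mk~
    (ℤ.+-injective (trans (sym (exponents-fromℕ u)) (trans (eq (fromℕ (suc (suc m)))) (exponents-fromℕ v))))
    λ i → ℤ.+-injective (trans (sym (exponents-inject₁ u i)) (trans (eq (inject₁ i)) (exponents-inject₁ v i)))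

  ~⇒exponents : ∀ {u v} → u ~ v → exponents u ≗ exponents v
  ~⇒exponents {u} {v} (mk~ l c) i with view i
  ... | ‵fromℕ     = trans (exponents-fromℕ u) (trans (cong ℤ.+_ l) (sym (exponents-fromℕ v)))
  ... | ‵inject₁ j = trans (exponents-inject₁ u j) (trans (cong ℤ.+_ (c j)) (sym (exponents-inject₁ v j)))

  -- The coefficient of image I₁ ⋯ image Iₖ, which L.product leaves as an unreduced product of ones.
  unitProduct : List V → K.Carrier
  unitProduct []      = K.1#
  unitProduct (I ∷ u) = K.1# K.* unitProduct u

  unitProduct≈1 : ∀ u → unitProduct u K.≈ K.1#
  unitProduct≈1 []      = K.refl
  unitProduct≈1 (I ∷ u) = K.trans (K.*-identityˡ _) (unitProduct≈1 u)

  k*unitProduct≈k : ∀ k u → k K.* unitProduct u K.≈ k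
  k*unitProduct≈k k u = K.trans (K.*-congˡ (unitProduct≈1 u)) (K.*-identityʳ k)

  product-image : ∀ u → L.product (List.map (image K) u) ≡ L.term (unitProduct u) (exponents u)
  product-image []      = refl
  product-image (I ∷ u) = cong (image K I L.*_) (product-image u)

  -- The summand 0 comes from the constant by which `toricMap` multiplies each product.
  toricExponents : List V → Fin (suc (suc (suc m))) → ℤ
  toricExponents u i = ℤ.+ 0 ℤ.+ exponents u i

  toricMap-∷ : ∀ k u f → toricMap K ((k , u) ∷ f) ≡ (k K.* unitProduct u , toricExponents u) ∷ toricMap K f
  toricMap-∷ k u f = cong (λ p → (L.constant k L.* p) L.+ toricMap K f) (product-image u)

  ~⇒toricExponents : ∀ {u v} → u ~ v → toricExponents u ≗ exponents v
  ~⇒toricExponents u~v i = trans (ℤ.+-identityˡ _) (~⇒exponents u~v i)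

  toricExponents⇒~ : ∀ {u v} → toricExponents u ≗ exponents v → u ~ v
  toricExponents⇒~ eq = exponents⇒~ λ i → trans (sym (ℤ.+-identityˡ _)) (eq i)

  fibreSum : Polynomial → List V → K.Carrier
  fibreSum f v = sumOver (_~? v) (λ u↭u′ → ~-trans (↭⇒~ (↭-sym u↭u′))) f

  -- Exactly the monomials in the fibre of `v` are sent to its exponent vector, so their
  -- coefficients add up.
  coeff-toricMap : ∀ f v → L.coeff (toricMap K f) (exponents v) K.≈ fibreSum f v
  coeff-toricMap []            v = K.refl
  coeff-toricMap ((k , u) ∷ f) v rewrite toricMap-∷ k u f with u ~? v
  ... | yes u~v = K.trans (L.coeff-∷-≈ (toricMap K f) (~⇒toricExponents u~v))
                          (K.+-cong (k*unitProduct≈k k u) (coeff-toricMap f v))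
  ... | no ¬u~v = K.trans (L.coeff-∷-≉ (toricMap K f) (λ eq → ¬u~v (toricExponents⇒~ eq))) (coeff-toricMap f v)

  binomial∈toric : ∀ {u v} → u ~ v → ToricIdeal K (monomial u - monomial v)
  binomial∈toric {u} {v} u~v
    rewrite toricMap-∷ K.1# u ((K.- K.1# , v) ∷ []) | toricMap-∷ (K.- K.1#) v [] =
    L.opposite-terms
      (K.trans (K.+-cong (k*unitProduct≈k K.1# u) (k*unitProduct≈k (K.- K.1#) v)) (K.-‿inverseʳ K.1#))
      (λ i → cong (ℤ._+_ ℤ.0ℤ) (~⇒exponents u~v i))

  -- Membership in the toric ideal makes the coefficients over the fibre of `u` sum to zero. If `u`
  -- is least there and nothing above it occurs, this sum is the coefficient of `u` alone.
  least-not-initial : ∀ {f u} → ToricIdeal K f → LeastInFibre u → ¬ IsInitial lexTermOrder f u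
  least-not-initial {f} {u} f∈I least (occurs , above) = K.#-irrefl coeff≈0 occurs
    where
    coeff≈0 : coeff f u K.≈ K.0#
    coeff≈0 = K.trans (K.sym (sumOver-unique (_~? u) (λ u↭u′ → ~-trans (↭⇒~ (↭-sym u↭u′))) f (↭⇒~ ↭-refl)
                               λ v v~u u≉v → above (least v v~u , u≉v)))
                      (K.trans (K.sym (coeff-toricMap f u)) (f∈I (exponents u)))

  markedTerm : ∀ {IJ} → ¬ Minimal IJ → MarkedTerms (G K) (collectionMonomial IJ)
  markedTerm {IJ} ¬minimal =
    let IJ⁻ , minimal , eq = minimalCollection IJ
    in _ , IJ , IJ⁻ , ¬minimal , minimal , eq , refl , refl

  ∣-refl : ∀ (u : List V) → u ∣ u
  ∣-refl u = [] , ↭-reflexive (List.++-identityʳ u)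

  G-inIdeal : ∀ {u g} → (u , g) ∈ G K → ToricIdeal K g
  G-inIdeal (IJ , IJ⁻ , _ , _ , eq , refl , refl) = binomial∈toric (~-sym (union⇒~ IJ⁻ IJ eq))

  minimal≉nonminimal : ∀ {k} (𝓘 𝓙 : Collection k) → Minimal 𝓘 → ¬ Minimal 𝓙 →
                       ¬ (collectionMonomial 𝓘 ↭ collectionMonomial 𝓙)
  minimal≉nonminimal 𝓘 𝓙 minimal ¬minimal 𝓘↭𝓙 = ¬minimal (least⇒minimal 𝓙 (least-resp-↭ 𝓘↭𝓙 (minimal⇒least 𝓘 minimal)))

  G-marked : ∀ {u g} → (u , g) ∈ G K → IsInitial lexTermOrder g u
  G-marked (IJ , IJ⁻ , ¬minimal , minimal , eq , refl , refl) =
    #-respˡ-≈ (K.sym coeff≈1) 1#0 , λ (u≼v , u≉v) →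
      -- The only other monomial is `u⁻`, which is least in the fibre of `u` and so cannot lie
      -- strictly above `u`.
      K.trans (coeff-∷-≉ ((K.- K.1# , u⁻) ∷ []) u≉v) (coeff-∷-≉ [] λ u⁻↭v →
        u≉v (≼.antisym u≼v (≼.trans (≼.reflexive (↭-sym u⁻↭v)) (minimal⇒least IJ⁻ minimal u (~-sym (union⇒~ IJ⁻ IJ eq))))))
    where
    u u⁻ : List V
    u = collectionMonomial IJ
    u⁻ = collectionMonomial IJ⁻
    coeff≈1 : coeff (monomial u - monomial u⁻) u K.≈ K.1#
    coeff≈1 = K.trans (coeff-∷-≈ ((K.- K.1# , u⁻) ∷ []) (↭-refl {x = u}))
      (K.trans (K.+-congˡ (coeff-∷-≉ [] (minimal≉nonminimal IJ⁻ IJ minimal ¬minimal))) (K.+-identityʳ _))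

  -- All differences of two words of length two are listed, a superset of `G`, which suffices.
  G-finite : ∃ λ ugs → ∀ {u g} → (u , g) ∈ G K → Any (λ (u′ , g′) → u ↭ u′ × g ≈ g′) ugs
  G-finite = cartesianProductWith (λ u v → u , (monomial u - monomial v)) (words allMultisets 2) (words allMultisets 2) ,
    λ { (mkCollection (I ∷ J ∷ []) _ , mkCollection (I′ ∷ J′ ∷ []) _ , _ , _ , _ , refl , refl) →
        lose (∈-cartesianProductWith⁺ _ (∈-words ∈-allMultisets (I ∷ J ∷ [])) (∈-words ∈-allMultisets (I′ ∷ J′ ∷ [])))
             (↭-refl , λ _ → K.refl) }

  -- An initial monomial is not least in its fibre, so it contains a pair that is not least.
  initial-divisor : ∀ {u} → (∃ λ f → f ∈ ToricIdeal K × IsInitial lexTermOrder f u) →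
                    ∃ λ (IJ : Collection 2) → ¬ Minimal IJ × collectionMonomial IJ ∣ u
  initial-divisor {u} (f , f∈I , initial) with least⊎¬leastPair u
  ... | inj₁ least = contradiction initial (least-not-initial {f} f∈I least)
  ... | inj₂ (I , J , w , u↭IJw , ¬least) =
    let IJ , IJ≡ = sortedCollection (I ∷ J ∷ []) refl
        IJ↭ = ↭-trans (↭-reflexive IJ≡) (sort-↭ (I ∷ J ∷ []))
    in IJ , (λ minimal → ¬least (least-resp-↭ IJ↭ (minimal⇒least IJ minimal))) ,
       w , ↭-trans (↭.++⁺ʳ w IJ↭) (↭-sym u↭IJw)

  G-generates : ⟨ Monomials (MarkedTerms (G K)) ⟩ ≐ InitialIdeal lexTermOrder (ToricIdeal K)
  G-generates =
    (λ {f} → ⟨⟩-⊆ (λ {u} (g , ug∈G) → u , (g , G-inIdeal ug∈G , G-marked ug∈G) , ∣-refl u) {f}) ,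
    (λ {f} → ⟨⟩-⊆ (λ initial → let IJ , ¬minimal , IJ∣u = initial-divisor initial in
                                 collectionMonomial IJ , markedTerm {IJ} ¬minimal , IJ∣u) {f})

  underlined-generate : InitialIdeal lexTermOrder (ToricIdeal K) ≐ ⟨ Monomials UnderlinedTerms ⟩
  underlined-generate =
    (λ {f} → ⟨⟩-⊆ (λ initial → let IJ , ¬minimal , IJ∣u = initial-divisor initial in
                                 collectionMonomial IJ , (IJ , ¬minimal , refl) , IJ∣u) {f}) ,
    (λ {f} → ⟨⟩-⊆ (λ { {u} (IJ , ¬minimal , refl) → let g , ug∈G = markedTerm {IJ} ¬minimal in
                                 u , (g , G-inIdeal ug∈G , G-marked ug∈G) , ∣-refl u }) {f})

  ∣-pairs⇒↭ : ∀ {IJ KL : Collection 2} → collectionMonomial IJ ∣ collectionMonomial KL →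
              collectionMonomial IJ ↭ collectionMonomial KL
  ∣-pairs⇒↭ {mkCollection (_ ∷ _ ∷ []) _} {mkCollection (_ ∷ _ ∷ []) _} ([] , IJ↭KL) = IJ↭KL
  ∣-pairs⇒↭ {mkCollection (_ ∷ _ ∷ []) _} {mkCollection (_ ∷ _ ∷ []) _} (_ ∷ _ , IJw↭KL) with () ← ↭.↭-length IJw↭KL

  -- Since `T` generates, each marked term has a divisor in `T`; this too is a marked term, and as
  -- both have degree two they coincide.
  G-minimal : IsMinimalGeneratingSet (MarkedTerms (G K)) (InitialIdeal lexTermOrder (ToricIdeal K))
  G-minimal = G-generates , λ T T⊑S (_ , I⊆⟨T⟩) {u} u∈S@(_ , IJ , _ , _ , _ , _ , u≡IJ , _) →
    let t , t∈T , (w , tw↭u) = monomial∈⟨⟩⁻ {u = u} (I⊆⟨T⟩ {monomial u} (proj₁ G-generates {monomial u} (monomial∈⟨⟩⁺ u∈S)))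
        t′ , (_ , KL , _ , _ , _ , _ , t′≡KL , _) , t↭t′ = T⊑S t∈T
        KL↭t = ↭-trans (↭-reflexive (sym t′≡KL)) (↭-sym t↭t′)
        KL↭IJ = ∣-pairs⇒↭ {KL} {IJ} (w , ↭-trans (↭.++⁺ʳ w KL↭t) (↭-trans tw↭u (↭-reflexive u≡IJ)))
    in t , t∈T , ↭-trans (↭-reflexive u≡IJ) (↭-trans (↭-sym KL↭IJ) KL↭t)

  -- The other term of `g` is a minimal pair. A nonminimal pair dividing it would equal it, both
  -- having degree two.
  G-reduced : ∀ {u g v h w} → (u , g) ∈ G K → (v , h) ∈ G K → OccursIn w g → ¬ (w ↭ u) → ¬ (v ∣ w)
  G-reduced {w = w} (IJ , IJ⁻ , _ , minimal , _ , refl , refl) (KL , _ , ¬minimal , _ , _ , refl , refl)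
            occurs w≉u (x , KLx↭w) =
    minimal≉nonminimal IJ⁻ KL minimal ¬minimal
      (↭-sym (∣-pairs⇒↭ {KL} {IJ⁻} (x , ↭-trans KLx↭w (↭-sym IJ⁻↭w))))
    where
    IJ⁻↭w : collectionMonomial IJ⁻ ↭ w
    IJ⁻↭w = decidable-stable (↭-dec _≟_ _ w) λ IJ⁻≉w →
      K.#-irrefl (K.trans (coeff-∷-≉ ((K.- K.1# , collectionMonomial IJ⁻) ∷ []) (w≉u ∘ ↭-sym)) (coeff-∷-≉ [] IJ⁻≉w)) occurs

  G-isReducedGröbnerBasis : IsReducedGröbnerBasis lexTermOrder (G K) (ToricIdeal K)
  G-isReducedGröbnerBasis = record
    { isGröbnerBasis = record
      { finite    = G-finite
      ; inIdeal   = G-inIdeal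
      ; marked    = G-marked
      ; generates = G-generates
      }
    ; minimal = G-minimal
    ; reduced = G-reduced
    }

theorem3 : (m : ℕ) (s : Fin (suc m) → ℕ) (s-positive : ∀ i → NonZero (s i)) →
    (∀ (i : Fin m) → s (inject₁ i) ≤ s (suc i)) →
    (∀ (i : Fin m) → s (suc i) ∸ s (inject₁ i) ≡ 0 ⊎ s (suc i) ∸ s (inject₁ i) ≡ 1) →
    ∀ {c ℓ₁ ℓ₂} (K : HeytingField c ℓ₁ ℓ₂) →
    let open LectureHall s s-positive
        open Polynomials K _≟_
    in ∃ λ (≻ : TermOrder LectureHallMultiset) →
      IsReducedGröbnerBasis ≻ (G K) (ToricIdeal K) ×
      InitialIdeal ≻ (ToricIdeal K) ≐ ⟨ Monomials UnderlinedTerms ⟩ ×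
      (∀ {u} → u ∈ UnderlinedTerms → Unique u)
theorem3 m s s-positive increasing steps K =
  lexTermOrder , G-isReducedGröbnerBasis , underlined-generate , underlined-unique
  where
  slow : Slow s
  slow i = Sum.map step step (steps i)
    where
    step : ∀ {d} → s (suc i) ∸ s (inject₁ i) ≡ d → s (suc i) ≡ d ℕ.+ s (inject₁ i)
    step eq = trans (sym (ℕ.m∸n+n≡m (increasing i))) (cong (ℕ._+ s (inject₁ i)) eq)
  open Fibres s s-positive slow
  open Collections s s-positive slow
  open ToricGröbner s s-positive slow K
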